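{- Assume the generalized Riemann hypothesis. Let $\Gamma$ be a finite abelian group with pairing of odd order. Then there exists a graph $G$ such that $\Gamma \cong \mathrm{Jac}(G)$ as groups with pairing.
   Context: The generalized Riemann hypothesis (GRH): for every Dirichlet character $\chi$, all zeros of the Dirichlet $L$-function $L(s,\chi)$ in the strip $0<\mathrm{Re}(s)<1$ lie on the line $\mathrm{Re}(s)=1/2$. A group with pairing is a finite abelian group $\Gamma$ together with a symmetric, bilinear, non-degenerate pairing $\langle\cdot,\cdot\rangle : \Gamma\times\Gamma \to \mathbb{Q}/\mathbb{Z}$; an isomorphism of groups with pairing is a group isomorphism preserving the pairings. A graph is a finite connected graph, possibly with multiple edges, but without loops. A divisor on $G$ is a formal integral combination $D=\sum_{v\in V(G)} D(v)v$, of degree $\sum_v D(v)$. For $f: V(G)\to\mathbb{Z}$ put $\mathrm{ord}_v(f)=\sum_{e=vw}(f(v)-f(w))$, the sum being over edges $e$ containing $v$ (counted with multiplicity), and $\mathrm{div}(f)=\sum_v \mathrm{ord}_v(f)v$. Divisors of the form $\mathrm{div}(f)$ are principal. The Jacobian $\mathrm{Jac}(G)$ is the (finite) group of degree-zero divisors modulo principal divisors. It carries the monodromy pairing: for degree-zero divisors $D_1,D_2$, choose an integer $m\geq 1$ and $f: V(G)\to\mathbb{Z}$ with $\mathrm{div}(f)=mD_1$, and set $\langle D_1,D_2\rangle=\frac1m\sum_{v\in V(G)} D_2(v)f(v) \in \mathbb{Q}/\mathbb{Z}$. As a group with pairing, $\mathrm{Jac}(G)$ is always equipped with this pairing. -}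

module Defs where

open import Level using (_⊔_; 0ℓ) renaming (suc to lsuc)
open import Algebra.Bundles using (AbelianGroup)
import Algebra.Properties.CommutativeMonoid.Sum as CommutativeMonoidSum
open import Algebra.Morphism.Structures using (module GroupMorphisms)
open import Data.Nat.Base as ℕ using (ℕ; zero; suc; NonZero)
import Data.Nat.Properties as ℕ
open import Data.Nat.Divisibility using (_∣_)
open import Data.Nat.GCD using (gcd)
open import Data.Integer.Base as ℤ using (ℤ; +_)
import Data.Integer.Properties as ℤ
import Data.Integer.Tactic.RingSolver as ℤ-Solver
open import Data.Rational.Base as ℚ using (ℚ; 0ℚ; 1ℚ; ½; ∣_∣; Positive)
import Data.Rational.Properties as ℚ
import Data.Rational.Solver as ℚ-Solver
open import Data.Fin.Base using (Fin)
open import Data.Product.Base using (Σ-syntax; ∃; ∃-syntax; _×_; _,_; proj₁; proj₂)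
open import Function.Bundles using (Inverse)
open import Relation.Binary.Construct.Closure.ReflexiveTransitive using (Star)
open import Relation.Binary.PropositionalEquality as ≡
  using (_≡_; _≢_; refl; sym; trans; cong; cong₂; subst)
open import Relation.Nullary.Negation using (¬_)

Cauchy : (ℕ → ℚ) → Set
Cauchy x = ∀ ε → .{{Positive ε}} →
  ∃[ N ] (∀ m n → N ℕ.≤ m → N ℕ.≤ n → ∣ x m ℚ.- x n ∣ ℚ.< ε)

record ℝ : Set where
  constructor real
  field
    seq    : ℕ → ℚ
    cauchy : Cauchy seq

open ℝ

private
  open ℚ-Solver.+-*-Solver using (solve; _:=_; _:+_; _:*_; _:-_; :-_)

  -- abstract, because unfolding these estimates makes type checking very slow
  abstract
    half : ∀ ε → .{{Positive ε}} → ∃[ δ ] Positive δ × δ ℚ.+ δ ≡ ε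
    half ε = ½ ℚ.* ε , ℚ.pos*pos⇒pos ½ ε ,
      trans (sym (ℚ.*-distribʳ-+ ε ½ ½)) (ℚ.*-identityˡ ε)

    divide : ∀ ε B → .{{Positive ε}} → .{{Positive B}} → ∃[ δ ] Positive δ × B ℚ.* δ ≡ ε
    divide ε B = B⁻¹ ℚ.* ε , ℚ.pos*pos⇒pos B⁻¹ {{ℚ.1/pos⇒pos B}} ε ,
      trans (sym (ℚ.*-assoc B B⁻¹ ε))
        (trans (cong (ℚ._* ε) (ℚ.*-inverseʳ B {{ℚ.pos⇒nonZero B}})) (ℚ.*-identityˡ ε))
      where
      B⁻¹ : ℚ
      B⁻¹ = (ℚ.1/ B) {{ℚ.pos⇒nonZero B}}

    bound : (x : ℝ) → ∃[ B ] Positive B × (∃[ N ] (∀ n → N ℕ.≤ n → ∣ seq x n ∣ ℚ.< B))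
    bound x with cauchy x 1ℚ
    ... | N , close = B , positive , N , λ n N≤n → begin-strict
        ∣ seq x n ∣
          ≡⟨ cong ∣_∣ (solve 2 (λ a b → a := (a :- b) :+ b) refl (seq x n) (seq x N)) ⟩
        ∣ (seq x n ℚ.- seq x N) ℚ.+ seq x N ∣
          ≤⟨ ℚ.∣p+q∣≤∣p∣+∣q∣ (seq x n ℚ.- seq x N) (seq x N) ⟩
        ∣ seq x n ℚ.- seq x N ∣ ℚ.+ ∣ seq x N ∣
          <⟨ ℚ.+-monoˡ-< ∣ seq x N ∣ (close n N N≤n ℕ.≤-refl) ⟩
        B ∎
      where
      open ℚ.≤-Reasoning
      B : ℚ
      B = 1ℚ ℚ.+ ∣ seq x N ∣
      positive : Positive B
      positive = ℚ.pos+nonNeg⇒pos 1ℚ ∣ seq x N ∣ {{ℚ.∣-∣-nonNeg (seq x N)}}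

    *-small : ∀ {a b B δ ε} → Positive B → B ℚ.* δ ≡ ε →
              ∣ a ∣ ℚ.< B → ∣ b ∣ ℚ.< δ → ∣ a ℚ.* b ∣ ℚ.< ε
    *-small {a} {b} {B} {δ} {ε} B>0 Bδ≡ε ∣a∣<B ∣b∣<δ = begin-strict
        ∣ a ℚ.* b ∣      ≡⟨ ℚ.∣p*q∣≡∣p∣*∣q∣ a b ⟩
        ∣ a ∣ ℚ.* ∣ b ∣  ≤⟨ ℚ.*-monoʳ-≤-nonNeg ∣ b ∣ {{ℚ.∣-∣-nonNeg b}} (ℚ.<⇒≤ ∣a∣<B) ⟩
        B ℚ.* ∣ b ∣      <⟨ ℚ.*-monoʳ-<-pos B {{B>0}} ∣b∣<δ ⟩
        B ℚ.* δ          ≡⟨ Bδ≡ε ⟩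
        ε ∎
      where open ℚ.≤-Reasoning

    +-small : ∀ {a b δ ε} → δ ℚ.+ δ ≡ ε → ∣ a ∣ ℚ.< δ → ∣ b ∣ ℚ.< δ → ∣ a ℚ.+ b ∣ ℚ.< ε
    +-small {a} {b} {δ} {ε} δ+δ≡ε ∣a∣<δ ∣b∣<δ = begin-strict
        ∣ a ℚ.+ b ∣      ≤⟨ ℚ.∣p+q∣≤∣p∣+∣q∣ a b ⟩
        ∣ a ∣ ℚ.+ ∣ b ∣  <⟨ ℚ.+-mono-< ∣a∣<δ ∣b∣<δ ⟩
        δ ℚ.+ δ          ≡⟨ δ+δ≡ε ⟩
        ε ∎
      where open ℚ.≤-Reasoning

    *-close : ∀ {a b c d A B α β δ ε} →
              Positive A → Positive B → A ℚ.* α ≡ δ → B ℚ.* β ≡ δ → δ ℚ.+ δ ≡ ε →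
              ∣ a ∣ ℚ.< A → ∣ d ∣ ℚ.< B → ∣ a ℚ.- b ∣ ℚ.< β → ∣ c ℚ.- d ∣ ℚ.< α →
              ∣ a ℚ.* c ℚ.- b ℚ.* d ∣ ℚ.< ε
    *-close {a} {b} {c} {d} {ε = ε} A>0 B>0 Aα≡δ Bβ≡δ δ+δ≡ε a<A d<B a-b<β c-d<α =
      subst (λ z → ∣ z ∣ ℚ.< ε)
        (solve 4 (λ a b c d → a :* (c :- d) :+ d :* (a :- b) := a :* c :- b :* d) refl a b c d)
        (+-small {a ℚ.* (c ℚ.- d)} {d ℚ.* (a ℚ.- b)} δ+δ≡ε
          (*-small {a} {c ℚ.- d} A>0 Aα≡δ a<A c-d<α)
          (*-small {d} {a ℚ.- b} B>0 Bβ≡δ d<B a-b<β))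

infixl 6 _+ʳ_ _-ʳ_
infixl 7 _*ʳ_
infix  8 -ʳ_
infix  4 _≈ʳ_ _<ʳ_ _≤ʳ_

fromℚ : ℚ → ℝ
fromℚ q = real (λ _ → q) λ ε → 0 , λ _ _ _ _ →
  subst (ℚ._< ε) (sym (cong ∣_∣ (ℚ.+-inverseʳ q))) (ℚ.positive⁻¹ ε)

_+ʳ_ : ℝ → ℝ → ℝ
x +ʳ y = real (λ n → seq x n ℚ.+ seq y n) cauchy′
  where
  cauchy′ : Cauchy (λ n → seq x n ℚ.+ seq y n)
  cauchy′ ε with half ε
  ... | δ , δ>0 , δ+δ≡ε with cauchy x δ {{δ>0}} | cauchy y δ {{δ>0}}
  ... | M , close-x | N , close-y = M ℕ.⊔ N , λ m n m≥ n≥ →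
    subst (λ z → ∣ z ∣ ℚ.< ε)
      (solve 4 (λ a b c d → (a :- b) :+ (c :- d) := (a :+ c) :- (b :+ d)) refl
        (seq x m) (seq x n) (seq y m) (seq y n))
      (+-small δ+δ≡ε
        (close-x m n (ℕ.m⊔n≤o⇒m≤o M N m≥) (ℕ.m⊔n≤o⇒m≤o M N n≥))
        (close-y m n (ℕ.m⊔n≤o⇒n≤o M N m≥) (ℕ.m⊔n≤o⇒n≤o M N n≥)))

-ʳ_ : ℝ → ℝ
-ʳ x = real (λ n → ℚ.- seq x n) λ ε → proj₁ (cauchy x ε) , λ m n m≥ n≥ →
  subst (ℚ._< ε)
    (cong ∣_∣ (solve 2 (λ a b → b :- a := :- a :- (:- b)) refl (seq x m) (seq x n)))
    (proj₂ (cauchy x ε) n m n≥ m≥)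

_-ʳ_ : ℝ → ℝ → ℝ
x -ʳ y = x +ʳ (-ʳ y)

_*ʳ_ : ℝ → ℝ → ℝ
x *ʳ y = real (λ n → seq x n ℚ.* seq y n) cauchy′
  where
  cauchy′ : Cauchy (λ n → seq x n ℚ.* seq y n)
  cauchy′ ε with half ε | bound x | bound y
  ... | δ , δ>0 , δ+δ≡ε | A , A>0 , K , x<A | B , B>0 , L , y<B
    with divide δ A {{δ>0}} {{A>0}} | divide δ B {{δ>0}} {{B>0}}
  ... | α , α>0 , Aα≡δ | β , β>0 , Bβ≡δ
    with cauchy x β {{β>0}} | cauchy y α {{α>0}}
  ... | M , close-x | N , close-y = (K ℕ.⊔ L) ℕ.⊔ (M ℕ.⊔ N) , λ m n m≥ n≥ →
    let KL≤ : ∀ {k} → (K ℕ.⊔ L) ℕ.⊔ (M ℕ.⊔ N) ℕ.≤ k → K ℕ.⊔ L ℕ.≤ k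
        KL≤ = ℕ.m⊔n≤o⇒m≤o (K ℕ.⊔ L) (M ℕ.⊔ N)
        MN≤ : ∀ {k} → (K ℕ.⊔ L) ℕ.⊔ (M ℕ.⊔ N) ℕ.≤ k → M ℕ.⊔ N ℕ.≤ k
        MN≤ = ℕ.m⊔n≤o⇒n≤o (K ℕ.⊔ L) (M ℕ.⊔ N)
    in *-close {seq x m} {seq x n} {seq y m} {seq y n} A>0 B>0 Aα≡δ Bβ≡δ δ+δ≡ε
      (x<A m (ℕ.m⊔n≤o⇒m≤o K L (KL≤ m≥)))
      (y<B n (ℕ.m⊔n≤o⇒n≤o K L (KL≤ n≥)))
      (close-x m n (ℕ.m⊔n≤o⇒m≤o M N (MN≤ m≥)) (ℕ.m⊔n≤o⇒m≤o M N (MN≤ n≥)))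
      (close-y m n (ℕ.m⊔n≤o⇒n≤o M N (MN≤ m≥)) (ℕ.m⊔n≤o⇒n≤o M N (MN≤ n≥)))

_≈ʳ_ : ℝ → ℝ → Set
x ≈ʳ y = ∀ ε → .{{Positive ε}} → ∃[ N ] (∀ n → N ℕ.≤ n → ∣ seq x n ℚ.- seq y n ∣ ℚ.< ε)

_<ʳ_ : ℝ → ℝ → Set
x <ʳ y = ∃[ ε ] Positive ε × (∃[ N ] (∀ n → N ℕ.≤ n → seq x n ℚ.+ ε ℚ.< seq y n))

_≤ʳ_ : ℝ → ℝ → Set
x ≤ʳ y = ¬ (y <ʳ x)

infixl 6 _+ᶜ_ _-ᶜ_
infixl 7 _*ᶜ_
infix  8 -ᶜ_
infix  4 _≈ᶜ_ _#ᶜ_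

record ℂ : Set where
  constructor _+i_
  field
    re im : ℝ

open ℂ public

fromℝ : ℝ → ℂ
fromℝ x = x +i fromℚ 0ℚ

fromℕ : ℕ → ℂ
fromℕ n = fromℝ (fromℚ (+ n ℚ./ 1))

0ᶜ 1ᶜ : ℂ
0ᶜ = fromℕ 0
1ᶜ = fromℕ 1

_+ᶜ_ _-ᶜ_ _*ᶜ_ : ℂ → ℂ → ℂ
(a +i b) +ᶜ (c +i d) = (a +ʳ c) +i (b +ʳ d)
(a +i b) -ᶜ (c +i d) = (a -ʳ c) +i (b -ʳ d)
(a +i b) *ᶜ (c +i d) = (a *ʳ c -ʳ b *ʳ d) +i (a *ʳ d +ʳ b *ʳ c)

-ᶜ_ : ℂ → ℂ
-ᶜ z = 0ᶜ -ᶜ z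

_^ᶜ_ : ℂ → ℕ → ℂ
z ^ᶜ zero  = 1ᶜ
z ^ᶜ suc n = z *ᶜ (z ^ᶜ n)

_≈ᶜ_ : ℂ → ℂ → Set
z ≈ᶜ w = re z ≈ʳ re w × im z ≈ʳ im w

∥_∥² : ℂ → ℝ
∥ z ∥² = re z *ʳ re z +ʳ im z *ʳ im z

_#ᶜ_ : ℂ → ℂ → Set
z #ᶜ w = fromℚ 0ℚ <ʳ ∥ z -ᶜ w ∥²

partialSum : (ℕ → ℂ) → ℕ → ℂ
partialSum a zero    = 0ᶜ
partialSum a (suc N) = partialSum a N +ᶜ a N

_⟶_ : (ℕ → ℂ) → ℂ → Set
a ⟶ z = ∀ ε → .{{Positive ε}} →
  ∃[ N ] (∀ n → N ℕ.≤ n → ∥ a n -ᶜ z ∥² <ʳ fromℚ (ε ℚ.* ε))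

HasSum : (ℕ → ℂ) → ℂ → Set
HasSum a z = partialSum a ⟶ z

1/_! : ℕ → ℚ
1/ zero !  = 1ℚ
1/ suc n ! = (+ 1 ℚ./ suc n) ℚ.* 1/ n !

-- w = exp z
IsExp : ℂ → ℂ → Set
IsExp z w = HasSum (λ n → fromℝ (fromℚ (1/ n !)) *ᶜ (z ^ᶜ n)) w

-- w = n ^ s = exp (s log n), where log n is the real logarithm of n
IsPower : ℕ → ℂ → ℂ → Set
IsPower n s w = Σ[ log-n ∈ ℝ ] IsExp (fromℝ log-n) (fromℕ n) × IsExp (s *ᶜ fromℝ log-n) w

-- A character modulo q, as a q-periodic function on the natural numbers
record DirichletCharacter : Set where
  field
    modulus          : ℕ
    {{modulus≢0}}    : NonZero modulus
    χ                : ℕ → ℂ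
    χ-1              : χ 1 ≈ᶜ 1ᶜ
    χ-multiplicative : ∀ m n → χ (m ℕ.* n) ≈ᶜ χ m *ᶜ χ n
    χ-periodic       : ∀ n → χ (n ℕ.+ modulus) ≈ᶜ χ n
    χ-noncoprime     : ∀ n → gcd n modulus ≢ 1 → χ n ≈ᶜ 0ᶜ

-- w = Σ_{n ≥ 1} χ(n) n^{-s}
IsDirichletSeries : DirichletCharacter → ℂ → ℂ → Set
IsDirichletSeries X s w =
  Σ[ n^-s ∈ (ℕ → ℂ) ] (∀ n → IsPower (suc n) (-ᶜ s) (n^-s n))
                    × HasSum (λ n → χ (suc n) *ᶜ n^-s n) w
  where open DirichletCharacter X

-- Functions on ℂ ∖ {1}.  The domain uses apartness, so that 1 / (s - 1) is such
-- a function.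
Punctured : Set
Punctured = ∀ s → s #ᶜ 1ᶜ → ℂ

Congruent : Punctured → Set
Congruent F = ∀ {s t} (s≠1 : s #ᶜ 1ᶜ) (t≠1 : t #ᶜ 1ᶜ) → s ≈ᶜ t → F s s≠1 ≈ᶜ F t t≠1

Holomorphic : Punctured → Set
Holomorphic F = ∀ s (s≠1 : s #ᶜ 1ᶜ) → Σ[ F′ ∈ ℂ ]
  (∀ ε → .{{Positive ε}} → ∃[ δ ] Positive δ × (∀ t (t≠1 : t #ᶜ 1ᶜ) →
    ∥ t -ᶜ s ∥² <ʳ fromℚ (δ ℚ.* δ) →
    ∥ (F t t≠1 -ᶜ F s s≠1) -ᶜ F′ *ᶜ (t -ᶜ s) ∥² ≤ʳ fromℚ (ε ℚ.* ε) *ʳ ∥ t -ᶜ s ∥²))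

-- L(s, χ) is the analytic continuation to ℂ ∖ {1} of the Dirichlet series, which
-- converges for Re s > 1.  The point 1 is left out because L(s, χ) has a pole
-- there when χ is principal; the identity theorem makes the continuation unique.
IsLFunction : DirichletCharacter → Punctured → Set
IsLFunction X L = Congruent L × Holomorphic L ×
  (∀ s (s≠1 : s #ᶜ 1ᶜ) → fromℚ 1ℚ <ʳ re s → IsDirichletSeries X s (L s s≠1))

GRH : Set
GRH = ∀ (X : DirichletCharacter) (L : Punctured) → IsLFunction X L →
  ∀ s (s≠1 : s #ᶜ 1ᶜ) → fromℚ 0ℚ <ʳ re s → re s <ʳ fromℚ 1ℚ →
  L s s≠1 ≈ᶜ 0ᶜ → re s ≈ʳ fromℚ ½

-- ℚ/ℤ is represented by ℚ with this equality
infix 4 _≡_mod-ℤ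
_≡_mod-ℤ : ℚ → ℚ → Set
p ≡ q mod-ℤ = ∃[ k ] p ℚ.- q ≡ k ℚ./ 1

record GroupWithPairing c ℓ : Set (lsuc (c ⊔ ℓ)) where
  field
    abelianGroup : AbelianGroup c ℓ
  open AbelianGroup abelianGroup public
  field
    order  : ℕ
    finite : Inverse setoid (≡.setoid (Fin order))

    ⟨_,_⟩         : Carrier → Carrier → ℚ
    ⟨,⟩-cong      : ∀ {x x′ y y′} → x ≈ x′ → y ≈ y′ → ⟨ x , y ⟩ ≡ ⟨ x′ , y′ ⟩ mod-ℤ
    symmetric     : ∀ x y → ⟨ x , y ⟩ ≡ ⟨ y , x ⟩ mod-ℤ
    bilinearˡ     : ∀ x y z → ⟨ x ∙ y , z ⟩ ≡ ⟨ x , z ⟩ ℚ.+ ⟨ y , z ⟩ mod-ℤ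
    bilinearʳ     : ∀ x y z → ⟨ x , y ∙ z ⟩ ≡ ⟨ x , y ⟩ ℚ.+ ⟨ x , z ⟩ mod-ℤ
    nondegenerate : ∀ x → (∀ y → ⟨ x , y ⟩ ≡ 0ℚ mod-ℤ) → x ≈ ε

OddOrder : ∀ {c ℓ} → GroupWithPairing c ℓ → Set
OddOrder Γ = ¬ (2 ∣ GroupWithPairing.order Γ)

-- edges v w is the number of edges joining v and w
record Graph : Set where
  field
    size       : ℕ
    {{size≢0}} : NonZero size
    edges      : Fin size → Fin size → ℕ
    undirected : ∀ v w → edges v w ≡ edges w v
    loopless   : ∀ v → edges v v ≡ 0
    connected  : ∀ v w → Star (λ x y → edges x y ≢ 0) v w

open CommutativeMonoidSum ℤ.+-0-commutativeMonoid
  using (sum; sum-cong-≗; ∑-distrib-+)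

module Jacobian (G : Graph) where
  open Graph G

  Vertex : Set
  Vertex = Fin size

  Divisor : Set
  Divisor = Vertex → ℤ

  deg : Divisor → ℤ
  deg D = sum D

  div : (Vertex → ℤ) → Divisor
  div f v = sum λ w → + edges v w ℤ.* (f v ℤ.- f w)

  Div⁰ : Set
  Div⁰ = Σ[ D ∈ Divisor ] deg D ≡ + 0

  infix 4 _~_
  _~_ : Div⁰ → Div⁰ → Set
  (D , _) ~ (E , _) = ∃[ f ] (∀ v → D v ℤ.- E v ≡ div f v)

  private
    sum-0 : ∀ n → sum {n} (λ _ → + 0) ≡ + 0
    sum-0 zero    = refl
    sum-0 (suc n) = trans (ℤ.+-identityˡ _) (sum-0 n)

    sum-neg : ∀ {n} (h : Fin n → ℤ) → sum (λ v → ℤ.- h v) ≡ ℤ.- sum h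
    sum-neg {n} h = begin
      s′                    ≡⟨ lemma s′ s ⟩
      (s′ ℤ.+ s) ℤ.- s     ≡⟨ cong (ℤ._- s) (∑-distrib-+ (λ v → ℤ.- h v) h) ⟨
      sum (λ v → ℤ.- h v ℤ.+ h v) ℤ.- s
                            ≡⟨ cong (ℤ._- s) (sum-cong-≗ (λ v → ℤ.+-inverseˡ (h v))) ⟩
      sum {n} (λ _ → + 0) ℤ.- s
                            ≡⟨ cong (ℤ._- s) (sum-0 n) ⟩
      + 0 ℤ.- s             ≡⟨ ℤ.+-identityˡ _ ⟩
      ℤ.- s ∎
      where
      open ≡.≡-Reasoning
      s′ = sum (λ v → ℤ.- h v)
      s  = sum h
      lemma : ∀ a b → a ≡ (a ℤ.+ b) ℤ.- b
      lemma = ℤ-Solver.solve-∀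

    div-0 : ∀ v → div (λ _ → + 0) v ≡ + 0
    div-0 v = trans (sum-cong-≗ (λ w → ℤ.*-zeroʳ (+ edges v w))) (sum-0 size)

    div-+ : ∀ f g v → div (λ w → f w ℤ.+ g w) v ≡ div f v ℤ.+ div g v
    div-+ f g v = trans (sum-cong-≗ (λ w → lemma (+ edges v w) (f v) (f w) (g v) (g w)))
      (∑-distrib-+ (λ w → + edges v w ℤ.* (f v ℤ.- f w)) (λ w → + edges v w ℤ.* (g v ℤ.- g w)))
      where
      lemma : ∀ e a b c d → e ℤ.* ((a ℤ.+ c) ℤ.- (b ℤ.+ d)) ≡ e ℤ.* (a ℤ.- b) ℤ.+ e ℤ.* (c ℤ.- d)
      lemma = ℤ-Solver.solve-∀

    div-neg : ∀ f v → div (λ w → ℤ.- f w) v ≡ ℤ.- div f v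
    div-neg f v = trans (sum-cong-≗ (λ w → lemma (+ edges v w) (f v) (f w)))
      (sum-neg (λ w → + edges v w ℤ.* (f v ℤ.- f w)))
      where
      lemma : ∀ e a b → e ℤ.* (ℤ.- a ℤ.- ℤ.- b) ≡ ℤ.- (e ℤ.* (a ℤ.- b))
      lemma = ℤ-Solver.solve-∀

    ≗⇒~ : ∀ {D E} → (∀ v → proj₁ D v ≡ proj₁ E v) → D ~ E
    ≗⇒~ {D} {E} eq = (λ _ → + 0) , λ v →
      trans (ℤ.i≡j⇒i-j≡0 (eq v)) (sym (div-0 v))

    ~-sym : ∀ {D E} → D ~ E → E ~ D
    ~-sym {D , _} {E , _} (f , eq) = (λ w → ℤ.- f w) , λ v →
      trans (lemma (D v) (E v)) (trans (cong ℤ.-_ (eq v)) (sym (div-neg f v)))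
      where
      lemma : ∀ a b → b ℤ.- a ≡ ℤ.- (a ℤ.- b)
      lemma = ℤ-Solver.solve-∀

    ~-trans : ∀ {D E F} → D ~ E → E ~ F → D ~ F
    ~-trans {D , _} {E , _} {F , _} (f , p) (g , q) = (λ w → f w ℤ.+ g w) , λ v →
      trans (lemma (D v) (E v) (F v)) (trans (cong₂ ℤ._+_ (p v) (q v)) (sym (div-+ f g v)))
      where
      lemma : ∀ a b c → a ℤ.- c ≡ (a ℤ.- b) ℤ.+ (b ℤ.- c)
      lemma = ℤ-Solver.solve-∀

  0⁰ : Div⁰
  0⁰ = (λ _ → + 0) , sum-0 size

  _+⁰_ : Div⁰ → Div⁰ → Div⁰
  (D , p) +⁰ (E , q) = (λ v → D v ℤ.+ E v) , trans (∑-distrib-+ D E) (cong₂ ℤ._+_ p q)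

  -⁰_ : Div⁰ → Div⁰
  -⁰ (D , p) = (λ v → ℤ.- D v) , trans (sum-neg D) (cong ℤ.-_ p)

  private
    +⁰-cong : ∀ {D D′ E E′} → D ~ D′ → E ~ E′ → (D +⁰ E) ~ (D′ +⁰ E′)
    +⁰-cong {D , _} {D′ , _} {E , _} {E′ , _} (f , p) (g , q) = (λ w → f w ℤ.+ g w) , λ v →
      trans (lemma (D v) (D′ v) (E v) (E′ v))
        (trans (cong₂ ℤ._+_ (p v) (q v)) (sym (div-+ f g v)))
      where
      lemma : ∀ a b c d → (a ℤ.+ c) ℤ.- (b ℤ.+ d) ≡ (a ℤ.- b) ℤ.+ (c ℤ.- d)
      lemma = ℤ-Solver.solve-∀

    -⁰-cong : ∀ {D E} → D ~ E → (-⁰ D) ~ (-⁰ E)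
    -⁰-cong {D , _} {E , _} (f , p) = (λ w → ℤ.- f w) , λ v →
      trans (lemma (D v) (E v)) (trans (cong ℤ.-_ (p v)) (sym (div-neg f v)))
      where
      lemma : ∀ a b → ℤ.- a ℤ.- ℤ.- b ≡ ℤ.- (a ℤ.- b)
      lemma = ℤ-Solver.solve-∀

  Jac : AbelianGroup 0ℓ 0ℓ
  Jac = record
    { Carrier = Div⁰
    ; _≈_     = _~_
    ; _∙_     = _+⁰_
    ; ε       = 0⁰
    ; _⁻¹     = -⁰_
    ; isAbelianGroup = record
      { isGroup = record
        { isMonoid = record
          { isSemigroup = record
            { isMagma = record
              { isEquivalence = record
                { refl  = λ {D} → ≗⇒~ {D} {D} (λ _ → refl)
                ; sym   = λ {D} {E} → ~-sym {D} {E}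
                ; trans = λ {D} {E} {F} → ~-trans {D} {E} {F}
                }
              ; ∙-cong = λ {D} {D′} {E} {E′} → +⁰-cong {D} {D′} {E} {E′}
              }
            ; assoc = λ D E F → ≗⇒~ {(D +⁰ E) +⁰ F} {D +⁰ (E +⁰ F)}
                (λ v → ℤ.+-assoc (proj₁ D v) (proj₁ E v) (proj₁ F v))
            }
          ; identity = (λ D → ≗⇒~ {0⁰ +⁰ D} {D} (λ v → ℤ.+-identityˡ (proj₁ D v)))
                     , (λ D → ≗⇒~ {D +⁰ 0⁰} {D} (λ v → ℤ.+-identityʳ (proj₁ D v)))
          }
        ; inverse = (λ D → ≗⇒~ {(-⁰ D) +⁰ D} {0⁰} (λ v → ℤ.+-inverseˡ (proj₁ D v)))
                  , (λ D → ≗⇒~ {D +⁰ (-⁰ D)} {0⁰} (λ v → ℤ.+-inverseʳ (proj₁ D v)))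
        ; ⁻¹-cong = λ {D} {E} → -⁰-cong {D} {E}
        }
      ; comm = λ D E → ≗⇒~ {D +⁰ E} {E +⁰ D} (λ v → ℤ.+-comm (proj₁ D v) (proj₁ E v))
      }
    }

  -- q represents ⟨ D₁ , D₂ ⟩ in ℚ/ℤ.  Suitable m and f exist because the Jacobian is
  -- finite, and since the graph is connected the value does not depend on their choice.
  record MonodromyPairing (D₁ D₂ : Div⁰) (q : ℚ) : Set where
    field
      m       : ℕ
      {{m≢0}} : NonZero m
      f       : Vertex → ℤ
      div-f   : ∀ v → div f v ≡ + m ℤ.* proj₁ D₁ v
      value   : q ≡ sum (λ v → proj₁ D₂ v ℤ.* f v) ℚ./ m mod-ℤ

record _≅Jac_ {c ℓ} (Γ : GroupWithPairing c ℓ) (G : Graph) : Set (c ⊔ ℓ) where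
  open GroupWithPairing Γ using (Carrier; rawGroup; ⟨_,_⟩)
  open Jacobian G
  open GroupMorphisms rawGroup (AbelianGroup.rawGroup Jac)
  field
    φ                : Carrier → Div⁰
    isIsomorphism    : IsGroupIsomorphism φ
    preservesPairing : ∀ x y → MonodromyPairing (φ x) (φ y) ⟨ x , y ⟩

{-# OPTIONS --safe #-}

-- View a graph as an electrical network of unit resistors.  If v − ρ has order n in
-- the Jacobian, then ⟨ v − ρ , v − ρ ⟩ = q / n is the effective resistance between
-- the vertices v and ρ.  Series and parallel connection realise every positive
-- rational number as a resistance, with the continued fraction of q / n as the
-- recipe, and the resulting graph has Jacobian ℤ/n, generated by v − ρ.  Glueing such
-- graphs at ρ gives orthogonal sums.
--
-- A pairing of odd order is such a sum: as 2 is invertible, the pairing is determined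
-- by the values ⟨ x , x ⟩, so that, unless Γ is trivial, some x of prime power order n
-- has ⟨ x , x ⟩ = q / n with q prime to n, and then Γ is the orthogonal sum of the
-- subgroup generated by x and its orthogonal complement.

module Submission where

open import Defs
open import Algebra.Bundles using (AbelianGroup)
import Algebra.Properties.CommutativeMonoid.Mult as Mult
import Algebra.Properties.CommutativeMonoid.Sum as Sum
import Algebra.Properties.Group as GroupProperties
open import Data.Fin.Base using (Fin; zero; suc)
open import Data.Fin.Permutation using (Permutation; permutation)
open import Data.Fin.Properties using (any?; _≟_)
open import Data.Integer.Base as ℤ using (ℤ; +_; 0ℤ; 1ℤ; _+_; _*_; _-_; -_)
import Data.Integer.DivMod as ℤ
import Data.Integer.Divisibility.Signed as ℤ∣
import Data.Integer.Properties as ℤ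
open import Data.Integer.Tactic.RingSolver using (solve-∀)
open import Data.List.Base using (List; []; _∷_; length; filter; allFin)
open import Data.List.Membership.Propositional using (_∈_; lose)
open import Data.List.Membership.Propositional.Properties using (∈-filter⁺; ∈-allFin)
open import Data.List.Properties using (filter-notAll)
open import Data.List.Relation.Unary.All using (All; []; _∷_)
open import Data.Nat.Base as ℕ using (ℕ; zero; suc; NonZero)
open import Data.Nat.Coprimality
  using (Coprime; coprime-divisor; coprime-Bézout; 0-coprimeTo-m⇒m≡1) renaming (sym to coprime-sym)
import Data.Nat.DivMod as ℕ
open import Data.Nat.Divisibility
  using (_∣_; divides; _∣?_; ∣-trans; ∣1⇒≡1; ∣m∣n⇒∣m+n; ∣n⇒∣m*n)
open import Data.Nat.GCD using (module Bézout)
open import Data.Nat.Induction using (<-wellFounded)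
open import Data.Nat.ListAction using (product)
open import Data.Nat.Primality
  using (Prime; prime[2]; prime⇒irreducible; prime⇒nonZero; prime⇒nonTrivial)
open import Data.Nat.Primality.Factorisation using (PrimeFactorisation; factorise)
import Data.Nat.Properties as ℕ
import Data.Nat.Tactic.RingSolver as ℕ-Solver
open import Data.Product.Base using (Σ-syntax; ∃; ∃-syntax; _×_; _,_; proj₁; proj₂)
open import Data.Rational.Base as ℚ using (ℚ; mkℚ; 0ℚ)
import Data.Rational.Properties as ℚ
import Data.Rational.Solver as ℚ-Solver
import Data.Rational.Unnormalised.Base as ℚᵘ
import Data.Rational.Unnormalised.Properties as ℚᵘ
open import Data.Sum.Base using (inj₁; inj₂)
open import Data.Unit.Base using (⊤; tt)
open import Data.Vec.Base using (Vec; []; _∷_; lookup)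
import Data.Vec.Functional as F
open import Function.Base using (id; _∘_)
open import Function.Bundles using (Inverse)
open import Induction.WellFounded using (Acc; acc)
open import Level using (0ℓ; _⊔_)
open import Relation.Binary.Bundles using (Setoid)
open import Relation.Binary.Construct.Closure.ReflexiveTransitive as Star
  using (Star; _◅_; _◅◅_; gmap)
open import Relation.Binary.PropositionalEquality as ≡
  using (_≡_; _≢_; subst; subst₂; cong; cong₂; module ≡-Reasoning)
import Relation.Binary.Reasoning.Setoid as SetoidReasoning
open import Relation.Nullary using (Dec; yes; no; ¬_; ¬?; _×-dec_; contradiction)
import Relation.Nullary.Decidable as Dec
open import Algebra.Properties.Semiring.Sum ℤ.+-*-semiring
  using (sum; sum-cong-≗; ∑-distrib-+; ∑-comm; *-distribˡ-sum; *-distribʳ-sum; sum-replicate-zero)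

-- Graphs from resistor networks

-- If the resistance between `v` and `ρ` is q / n, a unit resistor in series makes it (n + q) / n,
-- and `r` unit resistors in parallel add `r` to the reciprocal: the result is (n + q) / (n + r (n +
-- q)).
--
-- The order of the Jacobian is never computed. A network carries certificates instead: for each
-- generator a voltage function showing that its order divides nᵢ, and a proof that the generators
-- suffice. That there are no further relations comes from the pairing: a principal divisor, tested
-- against the i-th voltage function, gives a congruence modulo nᵢ from which the factor qᵢ can be
-- cancelled.
--
-- The element x is found through the exponent. Choose a prime p and a number d such that pd kills
-- the summand and d does not. Polarisation gives y with d ⟨ y , y ⟩ ≠ 0. If m is the part of d
-- prime to p, then x = m y works, and n is the exact power of p in pd.
--
-- All values of the pairing have denominator N, the order of Γ, so ℚ/ℤ is traded for integers
-- modulo N. Orthogonal summands stay decidable predicates on the one group Γ, so that N and the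
-- pairing are the same at every stage.

δ : ∀ {n} → Fin n → Fin n → ℕ
δ zero    zero    = 1
δ zero    (suc _) = 0
δ (suc _) zero    = 0
δ (suc u) (suc v) = δ u v

δ-refl : ∀ {n} (u : Fin n) → δ u u ≡ 1
δ-refl zero    = ≡.refl
δ-refl (suc u) = δ-refl u

δ-subst : ∀ {n} (u w : Fin n) (f : Fin n → ℤ) → + δ u w * f w ≡ + δ u w * f u
δ-subst zero    zero    f = ≡.refl
δ-subst zero    (suc w) f = ≡.refl
δ-subst (suc u) zero    f = ≡.refl
δ-subst (suc u) (suc w) f = δ-subst u w (f ∘ suc)

sum-0 : ∀ {n} {f : Fin n → ℤ} → (∀ i → f i ≡ 0ℤ) → sum f ≡ 0ℤ
sum-0 {n} f≡0 = ≡.trans (sum-cong-≗ f≡0) (sum-replicate-zero n)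

sum-δ : ∀ {n} (u : Fin n) (f : Fin n → ℤ) → sum (λ w → + δ u w * f w) ≡ f u
sum-δ zero f = ≡.trans (cong₂ _+_ (ℤ.*-identityˡ (f zero)) (sum-0 (λ w → ℤ.*-zeroˡ (f (suc w)))))
  (ℤ.+-identityʳ (f zero))
sum-δ (suc u) f = ≡.trans (ℤ.+-identityˡ _) (sum-δ u (f ∘ suc))

δ-sym : ∀ {n} (u v : Fin n) → δ u v ≡ δ v u
δ-sym zero    zero    = ≡.refl
δ-sym zero    (suc v) = ≡.refl
δ-sym (suc u) zero    = ≡.refl
δ-sym (suc u) (suc v) = δ-sym u v

sum-δʳ : ∀ {n} (u : Fin n) (f : Fin n → ℤ) → sum (λ w → f w * + δ w u) ≡ f u
sum-δʳ u f = ≡.trans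
  (sum-cong-≗ (λ w → ≡.trans (ℤ.*-comm (f w) (+ δ w u)) (cong (λ d → + d * f w) (δ-sym w u))))
  (sum-δ u f)

sum-neg : ∀ {n} (f : Fin n → ℤ) → sum (λ i → - f i) ≡ - sum f
sum-neg {zero}  f = ≡.refl
sum-neg {suc n} f = ≡.trans (cong (_+_ (- f zero)) (sum-neg (f ∘ suc)))
  (≡.sym (ℤ.neg-distrib-+ (f zero) (sum (f ∘ suc))))

Orders : ℕ → Set
Orders = Vec (ℕ × ℕ)

ord num : ∀ {k} → Orders k → Fin k → ℕ
ord L i = proj₁ (lookup L i)
num L i = proj₂ (lookup L i)

-- A graph whose Jacobian is the orthogonal sum of the cyclic groups ℤ/nᵢ with
-- ⟨1,1⟩ = qᵢ/nᵢ: the generators are the divisors vertex i − root.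
record Realization {k} (L : Orders k) : Set where
  field
    graph : Graph
  open Graph graph public
  open Jacobian graph public
  field
    root             : Vertex
    vertex           : Fin k → Vertex
    potential        : Fin k → Vertex → ℤ
    div-potential    : ∀ i w → div (potential i) w ≡ + ord L i * (+ δ (vertex i) w - + δ root w)
    potential-root   : ∀ i → potential i root ≡ 0ℤ
    potential-vertex : ∀ i j → potential i (vertex j) ≡ + δ i j * + num L i
    generates        : ∀ (D : Divisor) → Σ[ s ∈ ℤ ] Σ[ t ∈ (Fin k → ℤ) ] Σ[ g ∈ (Vertex → ℤ) ] ∀ w →
      D w ≡ s * + δ root w + sum (λ i → t i * + δ (vertex i) w) + div g w

module Extension (G : Graph) (h ρ : Fin (Graph.size G)) (r : ℕ) where
  open Graph G
  open Jacobian G using (div)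

  -- A sum, so that `h` and `ρ` may coincide, as they do right after `add-root`.
  spokes : Fin size → ℕ
  spokes w = δ h w ℕ.+ r ℕ.* δ ρ w

  edges′ : Fin (suc size) → Fin (suc size) → ℕ
  edges′ zero    zero    = 0
  edges′ zero    (suc w) = spokes w
  edges′ (suc w) zero    = spokes w
  edges′ (suc v) (suc w) = edges v w

  undirected′ : ∀ v w → edges′ v w ≡ edges′ w v
  undirected′ zero    zero    = ≡.refl
  undirected′ zero    (suc w) = ≡.refl
  undirected′ (suc v) zero    = ≡.refl
  undirected′ (suc v) (suc w) = undirected v w

  loopless′ : ∀ v → edges′ v v ≡ 0
  loopless′ zero    = ≡.refl
  loopless′ (suc v) = loopless v

  spoke-h : spokes h ≢ 0
  spoke-h eq with () ← ≡.trans (≡.sym (δ-refl h)) (ℕ.m+n≡0⇒m≡0 (δ h h) eq)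

  connected′ : ∀ v w → Star (λ x y → edges′ x y ≢ 0) v w
  connected′ zero    zero    = Star.ε
  connected′ zero    (suc w) = spoke-h ◅ gmap suc id (connected h w)
  connected′ (suc v) zero    = gmap suc id (connected v h) ◅◅ (spoke-h ◅ Star.ε)
  connected′ (suc v) (suc w) = gmap suc id (connected v w)

  extension : Graph
  extension = record
    { size       = suc size
    ; edges      = edges′
    ; undirected = undirected′
    ; loopless   = loopless′
    ; connected  = connected′
    }

  open Jacobian extension using () renaming (div to div′)

  spokes-* : ∀ (f : Fin size → ℤ) w →
    + spokes w * f w ≡ + δ h w * f h + + r * (+ δ ρ w * f ρ)
  spokes-* f w = begin
    + spokes w * f w
      ≡⟨ cong (λ x → (+ δ h w + x) * f w) (ℤ.pos-* r (δ ρ w)) ⟩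
    (+ δ h w + + r * + δ ρ w) * f w
      ≡⟨ distrib (+ δ h w) (+ r) (+ δ ρ w) (f w) ⟩
    + δ h w * f w + + r * (+ δ ρ w * f w)
      ≡⟨ cong₂ (λ x y → x + + r * y) (δ-subst h w f) (δ-subst ρ w f) ⟩
    + δ h w * f h + + r * (+ δ ρ w * f ρ) ∎
    where
    open ≡-Reasoning
    distrib : ∀ a r b x → (a + r * b) * x ≡ a * x + r * (b * x)
    distrib = solve-∀

  div-zero : ∀ c g → div′ (c F.∷ g) zero ≡ (c - g h) + + r * (c - g ρ)
  div-zero c g = begin
    div′ (c F.∷ g) zero
      ≡⟨ ℤ.+-identityˡ _ ⟩
    sum (λ w → + spokes w * f w)
      ≡⟨ sum-cong-≗ (spokes-* f) ⟩
    sum (λ w → + δ h w * f h + + r * (+ δ ρ w * f ρ))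
      ≡⟨ ∑-distrib-+ (λ w → + δ h w * f h) (λ w → + r * (+ δ ρ w * f ρ)) ⟩
    sum (λ w → + δ h w * f h) + sum (λ w → + r * (+ δ ρ w * f ρ))
      ≡⟨ cong (λ x → sum (λ w → + δ h w * f h) + x) (*-distribˡ-sum (+ r) (λ w → + δ ρ w * f ρ)) ⟨
    sum (λ w → + δ h w * f h) + + r * sum (λ w → + δ ρ w * f ρ)
      ≡⟨ cong₂ (λ x y → x + + r * y) (sum-δ h (λ _ → f h)) (sum-δ ρ (λ _ → f ρ)) ⟩
    f h + + r * f ρ ∎
    where
    open ≡-Reasoning
    f : Fin size → ℤ
    f w = c - g w

  div-suc : ∀ c g w →
    div′ (c F.∷ g) (suc w) ≡ + δ h w * (g h - c) + + r * (+ δ ρ w * (g ρ - c)) + div g w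
  div-suc c g w = cong (_+ div g w) (spokes-* (λ w → g w - c) w)

point : Realization []
point = record
  { graph = record
    { size = 1 ; edges = λ _ _ → 0 ; undirected = λ _ _ → ≡.refl ; loopless = λ _ → ≡.refl
    ; connected = λ { zero zero → Star.ε } }
  ; root = zero
  ; vertex = λ ()
  ; potential = λ ()
  ; div-potential = λ ()
  ; potential-root = λ ()
  ; potential-vertex = λ ()
  ; generates = λ D → D zero , (λ ()) , (λ _ → 0ℤ) , λ { zero → lemma (D zero) }
  }
  where
  lemma : ∀ d → d ≡ d * + 1 + 0ℤ + 0ℤ
  lemma = solve-∀

-- The empty chain: a generator with resistance 0, placed at `root` itself. Since `extend` joins its
-- new vertex only to the end of the current chain and to `root`, different chains meet at `root`
-- alone, which is the glueing.
add-root : ∀ {k} {L : Orders k} → Realization L → Realization ((1 , 0) ∷ L)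
add-root {k} {L} R = record
  { graph            = graph
  ; root             = root
  ; vertex           = root F.∷ vertex
  ; potential        = (λ _ → 0ℤ) F.∷ potential
  ; div-potential    = λ
    { zero    w → ≡.trans (sum-0 (λ v → ℤ.*-zeroʳ (+ edges w v))) (lemma₁ (+ δ root w))
    ; (suc i) w → div-potential i w }
  ; potential-root   = λ { zero → ≡.refl ; (suc i) → potential-root i }
  ; potential-vertex = λ
    { zero    zero    → ≡.refl
    ; zero    (suc j) → ≡.refl
    ; (suc i) zero    → potential-root i
    ; (suc i) (suc j) → potential-vertex i j }
  ; generates        = λ D → let s , t , g , eq = generates D in
      s , 0ℤ F.∷ t , g , λ w → ≡.trans (eq w)
        (cong (λ x → s * + δ root w + x + div g w)
          (≡.sym (≡.trans
            (cong (_+ sum (λ i → t i * + δ (vertex i) w)) (ℤ.*-zeroˡ (+ δ root w)))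
            (ℤ.+-identityˡ _))))
  }
  where
  open Realization R
  lemma₁ : ∀ d → 0ℤ ≡ + 1 * (d - d)
  lemma₁ = solve-∀

-- In electrical terms this is a unit resistor in series with the first generator,
-- followed by r unit resistors in parallel.
extend : ∀ {k n q} {L : Orders k} r → Realization ((n , q) ∷ L) →
         Realization ((n ℕ.+ r ℕ.* (n ℕ.+ q) , n ℕ.+ q) ∷ L)
extend {k} {n} {q} {L} r R = record
  { graph            = extension
  ; root             = suc root
  ; vertex           = vertex′
  ; potential        = potential′
  ; div-potential    = div-potential′
  ; potential-root   = λ { zero → potential-root zero ; (suc i) → potential-root (suc i) }
  ; potential-vertex = λ
    { zero    zero    → ≡.sym (ℤ.*-identityˡ (+ (n ℕ.+ q)))
    ; zero    (suc j) → potential-vertex zero (suc j)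
    ; (suc i) zero    → ≡.refl
    ; (suc i) (suc j) → potential-vertex (suc i) (suc j) }
  ; generates        = generates′
  }
  where
  open Realization R
  h : Vertex
  h = vertex zero
  open Extension graph h root r
  open Jacobian extension using () renaming (div to div′)

  order′ : ℕ
  order′ = n ℕ.+ r ℕ.* (n ℕ.+ q)

  vertex′ : Fin (suc k) → Fin (suc size)
  vertex′ zero    = zero
  vertex′ (suc i) = suc (vertex (suc i))

  potential′ : Fin (suc k) → Fin (suc size) → ℤ
  -- The old voltage function has value `q` at `h` and expects a current `n` to enter there. The
  -- series resistor supplies it if the new vertex lies `n` higher.
  potential′ zero    = + (n ℕ.+ q) F.∷ potential zero
  -- The other voltage functions vanish at both `h` and `root`, so at voltage 0 the new vertex draws
  -- no current.
  potential′ (suc i) = 0ℤ F.∷ potential (suc i)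

  f₀ : Vertex → ℤ
  f₀ = potential zero

  f₀-h : f₀ h ≡ + q
  f₀-h = ≡.trans (potential-vertex zero zero) (ℤ.*-identityˡ (+ q))

  order-+ : + order′ ≡ + n + + r * (+ n + + q)
  order-+ = cong (λ x → + n + x) (ℤ.pos-* r (n ℕ.+ q))

  div-potential′ : ∀ i w → div′ (potential′ i) w ≡
    + ord ((order′ , n ℕ.+ q) ∷ L) i * (+ δ (vertex′ i) w - + δ (suc root) w)
  div-potential′ zero zero = begin
    div′ (potential′ zero) zero
      ≡⟨ div-zero (+ (n ℕ.+ q)) f₀ ⟩
    (+ n + + q - f₀ h) + + r * (+ n + + q - f₀ root)
      ≡⟨ cong₂ (λ x y → (+ n + + q - x) + + r * (+ n + + q - y)) f₀-h (potential-root zero) ⟩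
    (+ n + + q - + q) + + r * (+ n + + q - 0ℤ)
      ≡⟨ lemma (+ n) (+ q) (+ r) ⟩
    (+ n + + r * (+ n + + q)) * + 1
      ≡⟨ cong (_* + 1) order-+ ⟨
    + order′ * + 1 ∎
    where
    open ≡-Reasoning
    lemma : ∀ n q r → (n + q - q) + r * (n + q - 0ℤ) ≡ (n + r * (n + q)) * + 1
    lemma = solve-∀
  div-potential′ zero (suc w) = begin
    div′ (potential′ zero) (suc w)
      ≡⟨ div-suc (+ (n ℕ.+ q)) f₀ w ⟩
    a * (f₀ h - (+ n + + q)) + + r * (b * (f₀ root - (+ n + + q))) + div f₀ w
      ≡⟨ cong₂ (λ x y → a * (x - (+ n + + q)) + + r * (b * (y - (+ n + + q))) + div f₀ w)
           f₀-h (potential-root zero) ⟩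
    a * (+ q - (+ n + + q)) + + r * (b * (0ℤ - (+ n + + q))) + div f₀ w
      ≡⟨ cong (λ x → a * (+ q - (+ n + + q)) + + r * (b * (0ℤ - (+ n + + q))) + x) (div-potential zero w) ⟩
    a * (+ q - (+ n + + q)) + + r * (b * (0ℤ - (+ n + + q))) + + n * (a - b)
      ≡⟨ lemma a b (+ n) (+ q) (+ r) ⟩
    (+ n + + r * (+ n + + q)) * (0ℤ - b)
      ≡⟨ cong (_* (0ℤ - b)) order-+ ⟨
    + order′ * (0ℤ - b) ∎
    where
    open ≡-Reasoning
    a b : ℤ
    a = + δ h w
    b = + δ root w
    lemma : ∀ a b n q r → a * (q - (n + q)) + r * (b * (0ℤ - (n + q))) + n * (a - b) ≡
                          (n + r * (n + q)) * (0ℤ - b)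
    lemma = solve-∀
  div-potential′ (suc i) zero = begin
    div′ (potential′ (suc i)) zero
      ≡⟨ div-zero 0ℤ (potential (suc i)) ⟩
    (0ℤ - potential (suc i) h) + + r * (0ℤ - potential (suc i) root)
      ≡⟨ cong₂ (λ x y → (0ℤ - x) + + r * (0ℤ - y)) (potential-vertex (suc i) zero) (potential-root (suc i)) ⟩
    0ℤ + + r * 0ℤ
      ≡⟨ lemma (+ r) (+ ord L i) ⟩
    + ord L i * 0ℤ ∎
    where
    open ≡-Reasoning
    lemma : ∀ r n → 0ℤ + r * 0ℤ ≡ n * 0ℤ
    lemma = solve-∀
  div-potential′ (suc i) (suc w) = begin
    div′ (potential′ (suc i)) (suc w)
      ≡⟨ div-suc 0ℤ (potential (suc i)) w ⟩
    a * (potential (suc i) h - 0ℤ) + + r * (b * (potential (suc i) root - 0ℤ)) + div (potential (suc i)) w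
      ≡⟨ cong₂ (λ x y → a * (x - 0ℤ) + + r * (b * (y - 0ℤ)) + div (potential (suc i)) w)
           (potential-vertex (suc i) zero) (potential-root (suc i)) ⟩
    a * 0ℤ + + r * (b * 0ℤ) + div (potential (suc i)) w
      ≡⟨ lemma a b (+ r) (div (potential (suc i)) w) ⟩
    div (potential (suc i)) w
      ≡⟨ div-potential (suc i) w ⟩
    + ord L i * (+ δ (vertex (suc i)) w - b) ∎
    where
    open ≡-Reasoning
    a b : ℤ
    a = + δ h w
    b = + δ root w
    lemma : ∀ a b r x → a * 0ℤ + r * (b * 0ℤ) + x ≡ x
    lemma = solve-∀

  generates′ : ∀ (D : Fin (suc size) → ℤ) →
    Σ[ s ∈ ℤ ] Σ[ t ∈ (Fin (suc k) → ℤ) ] Σ[ g ∈ (Fin (suc size) → ℤ) ] ∀ w → D w ≡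
    s * + δ (suc root) w + sum (λ i → t i * + δ (vertex′ i) w) + div′ g w
  generates′ D with generates (D ∘ suc)
  ... | s , t , g , eq = s′ , (D zero - div′ g′ zero) F.∷ (t ∘ suc) , g′ , λ
    { zero → begin
        D zero
          ≡⟨ lemma₁ (D zero) (div′ g′ zero) s′ ⟩
        s′ * 0ℤ + ((D zero - div′ g′ zero) * + 1 + 0ℤ) + div′ g′ zero
          ≡⟨ cong (λ x → s′ * 0ℤ + ((D zero - div′ g′ zero) * + 1 + x) + div′ g′ zero)
               (sum-0 (λ i → ℤ.*-zeroʳ (t (suc i)))) ⟨
        s′ * 0ℤ + ((D zero - div′ g′ zero) * + 1 + sum (λ i → t (suc i) * 0ℤ)) + div′ g′ zero ∎
    ; (suc w) → let a = + δ h w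
                    b = + δ root w
                    rest = sum (λ i → t (suc i) * + δ (vertex (suc i)) w) in begin
        D (suc w)
          ≡⟨ eq w ⟩
        s * b + (t zero * a + rest) + div g w
          ≡⟨ lemma₂ s b (t zero) a rest (div g w) (g h) (g root) (+ r) (D zero - div′ g′ zero) ⟩
        s′ * b + ((D zero - div′ g′ zero) * 0ℤ + rest) +
          (a * (g h - c) + + r * (b * (g root - c)) + div g w)
          ≡⟨ cong (λ x → s′ * b + ((D zero - div′ g′ zero) * 0ℤ + rest) + x) (div-suc c g w) ⟨
        s′ * b + ((D zero - div′ g′ zero) * 0ℤ + rest) + div′ g′ (suc w) ∎
    }
    where
    open ≡-Reasoning
    c s′ : ℤ
    -- The vertex `h` is no longer a generator. With this value at the new vertex, the edge to `h`
    -- contributes `t zero` to the divisor at `h`. The `r` edges to `root` are compensated in `s′`,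
    -- and the coefficient of the new generator makes up the difference at the new vertex.
    c  = g h - t zero
    s′ = s - + r * (g root - c)
    g′ : Fin (suc size) → ℤ
    g′ = c F.∷ g
    lemma₁ : ∀ d x s → d ≡ s * 0ℤ + ((d - x) * + 1 + 0ℤ) + x
    lemma₁ = solve-∀
    lemma₂ : ∀ s b t a y d gh gr r x → s * b + (t * a + y) + d ≡
      (s - r * (gr - (gh - t))) * b + (x * 0ℤ + y) +
        (a * (gh - (gh - t)) + r * (b * (gr - (gh - t))) + d)
    lemma₂ = solve-∀

-- The subtractive Euclidean algorithm, run backwards by extend.
add-cyclic : ∀ {k n q} {L : Orders k} → .{{NonZero n}} → Coprime n q →
             Realization L → Realization ((n , q) ∷ L)
add-cyclic {L = L} coprime R = go coprime (<-wellFounded _)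
  where
  go : ∀ {n q} → .{{NonZero n}} → Coprime n q → Acc ℕ._<_ q → Realization ((n , q) ∷ L)
  go {n} {zero} coprime _ = subst (λ n → Realization ((n , 0) ∷ L))
    (≡.sym (0-coprimeTo-m⇒m≡1 (coprime-sym coprime))) (add-root R)
  go {suc n} {q@(suc q-1)} coprime (acc rec) =
    subst Realization (cong₂ (λ x y → (x , y) ∷ L) order-eq n₀+q₀≡q)
      (extend r (go coprime₀ (rec q₀<q)))
    where
    n₀ q₀ r : ℕ
    -- The remainder of the order `suc n` modulo `q`, taken between 1 and `q`, because an order must
    -- not be 0. If it is `q` itself, then `q₀` is 0 and coprimality forces `n₀` to be 1, the base
    -- case.
    n₀ = suc (n ℕ.% q)
    q₀ = q ℕ.∸ n₀
    r  = n ℕ./ q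
    n₀+q₀≡q : n₀ ℕ.+ q₀ ≡ q
    n₀+q₀≡q = ℕ.m+[n∸m]≡n (ℕ.m%n<n n q)
    order-eq : n₀ ℕ.+ r ℕ.* (n₀ ℕ.+ q₀) ≡ suc n
    order-eq = ≡.trans (cong (λ x → n₀ ℕ.+ r ℕ.* x) n₀+q₀≡q) (cong suc (≡.sym (ℕ.m≡m%n+[m/n]*n n q)))
    q₀<q : q₀ ℕ.< q
    q₀<q = ℕ.s≤s (ℕ.m∸n≤m q-1 (n ℕ.% q))
    coprime₀ : Coprime n₀ q₀
    coprime₀ {d} (d∣n₀ , d∣q₀) = coprime
      ( subst (d ∣_) order-eq (∣m∣n⇒∣m+n d∣n₀ (∣n⇒∣m*n r (∣m∣n⇒∣m+n d∣n₀ d∣q₀)))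
      , subst (d ∣_) n₀+q₀≡q (∣m∣n⇒∣m+n d∣n₀ d∣q₀))

realize : ∀ {k} (L : Orders k) → (∀ i → NonZero (ord L i)) → (∀ i → Coprime (ord L i) (num L i)) →
          Realization L
realize []      _   _       = point
realize (_ ∷ L) n≢0 coprime =
  add-cyclic {{n≢0 zero}} (coprime zero) (realize L (n≢0 ∘ suc) (coprime ∘ suc))

-- Congruences and ℚ/ℤ

infix 4 _≡_mod_
-- The equation is solved for `a`, so that matching it with `refl` eliminates `a` and leaves a ring
-- identity.
record _≡_mod_ (a b : ℤ) (n : ℕ) : Set where
  constructor modulo
  field
    quotient : ℤ
    equality : a ≡ b + quotient * + n

module _ {n : ℕ} where

  mod-reflexive : ∀ {a b} → a ≡ b → a ≡ b mod n
  mod-reflexive {a} ≡.refl = modulo 0ℤ (lemma a (+ n))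
    where
    lemma : ∀ a n → a ≡ a + 0ℤ * n
    lemma = solve-∀

  mod-sym : ∀ {a b} → a ≡ b mod n → b ≡ a mod n
  mod-sym {b = b} (modulo k ≡.refl) = modulo (- k) (lemma b k (+ n))
    where
    lemma : ∀ b k n → b ≡ b + k * n + - k * n
    lemma = solve-∀

  mod-trans : ∀ {a b c} → a ≡ b mod n → b ≡ c mod n → a ≡ c mod n
  mod-trans {c = c} (modulo k ≡.refl) (modulo l ≡.refl) = modulo (l + k) (lemma c k l (+ n))
    where
    lemma : ∀ c k l n → c + l * n + k * n ≡ c + (l + k) * n
    lemma = solve-∀

  mod-+ : ∀ {a b c d} → a ≡ b mod n → c ≡ d mod n → a + c ≡ b + d mod n
  mod-+ {b = b} {d = d} (modulo k ≡.refl) (modulo l ≡.refl) = modulo (k + l) (lemma b d k l (+ n))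
    where
    lemma : ∀ b d k l n → b + k * n + (d + l * n) ≡ b + d + (k + l) * n
    lemma = solve-∀

  mod-*ˡ : ∀ {a b} c → a ≡ b mod n → c * a ≡ c * b mod n
  mod-*ˡ {b = b} c (modulo k ≡.refl) = modulo (c * k) (lemma b c k (+ n))
    where
    lemma : ∀ b c k n → c * (b + k * n) ≡ c * b + (c * k) * n
    lemma = solve-∀

  mod-*ʳ : ∀ {a b} c → a ≡ b mod n → a * c ≡ b * c mod n
  mod-*ʳ {a} {b} c p = subst₂ (_≡_mod n) (ℤ.*-comm c a) (ℤ.*-comm c b) (mod-*ˡ c p)

  mod-neg : ∀ {a b} → a ≡ b mod n → - a ≡ - b mod n
  mod-neg {b = b} (modulo k ≡.refl) = modulo (- k) (lemma b k (+ n))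
    where
    lemma : ∀ b k n → - (b + k * n) ≡ - b + - k * n
    lemma = solve-∀

  mod-% : .{{_ : NonZero n}} → ∀ a → + (a ℤ.%ℕ n) ≡ a mod n
  mod-% a = mod-sym (modulo (a ℤ./ℕ n) (ℤ.a≡a%ℕn+[a/ℕn]*n a n))

  mod-setoid : Setoid 0ℓ 0ℓ
  mod-setoid = record
    { _≈_ = _≡_mod n
    ; isEquivalence = record { refl = mod-reflexive ≡.refl ; sym = mod-sym ; trans = mod-trans }
    }

  mod-sum : ∀ {k} {f g : _} → (∀ i → f i ≡ g i mod n) → sum {k} f ≡ sum g mod n
  mod-sum {zero}  f≡g = mod-reflexive ≡.refl
  mod-sum {suc k} f≡g = mod-+ (f≡g zero) (mod-sum (f≡g ∘ suc))

module mod-Reasoning (n : ℕ) where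
  open SetoidReasoning (mod-setoid {n}) public

infix 4 _≡?_mod_
_≡?_mod_ : ∀ a b n → Dec (a ≡ b mod n)
a ≡? b mod n = Dec.map′
  (λ { (ℤ∣.divides k eq) → modulo k (≡.trans (lemma₁ a b) (cong (_+_ b) eq)) })
  (λ { (modulo k ≡.refl) → ℤ∣.divides k (lemma₂ b k (+ n)) })
  (+ n ℤ∣.∣? (a - b))
  where
  lemma₁ : ∀ a b → a ≡ b + (a - b)
  lemma₁ = solve-∀
  lemma₂ : ∀ b k n → b + k * n - b ≡ k * n
  lemma₂ = solve-∀

mod-scale : ∀ {a b n N} e → n ℕ.* e ≡ N → a ≡ b mod n → + e * a ≡ + e * b mod N
mod-scale {b = b} {n} e ≡.refl (modulo k ≡.refl) = modulo k (≡.trans (lemma b k (+ n) (+ e))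
  (cong (λ x → + e * b + k * x) (≡.sym (ℤ.pos-* n e))))
  where
  lemma : ∀ b k n e → e * (b + k * n) ≡ e * b + k * (n * e)
  lemma = solve-∀

mod-unscale : ∀ {a b n N} e .{{_ : NonZero e}} → n ℕ.* e ≡ N → + e * a ≡ + e * b mod N → a ≡ b mod n
mod-unscale {a} {b} {n} e ≡.refl (modulo k eq) = modulo k (ℤ.*-cancelˡ-≡ (+ e) a (b + k * + n)
  (≡.trans eq (≡.trans (cong (λ x → + e * b + k * x) (ℤ.pos-* n e)) (lemma b k (+ n) (+ e)))))
  where
  lemma : ∀ b k n e → e * b + k * (n * e) ≡ e * (b + k * n)
  lemma = solve-∀

-- Applied to values of `B` at an element killed by `n`: they are multiples of `e`, so the pairing
-- takes values with denominator `n` there.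
exact-quotient : ∀ {a n N} e .{{_ : NonZero n}} → n ℕ.* e ≡ N → + n * a ≡ 0ℤ mod N → ∃[ b ] a ≡ + e * b
exact-quotient {a} {n} e ≡.refl (modulo k eq) = k , ℤ.*-cancelˡ-≡ (+ n) a (+ e * k)
  (≡.trans eq (≡.trans (cong (λ x → 0ℤ + k * x) (ℤ.pos-* n e)) (lemma k (+ n) (+ e))))
  where
  lemma : ∀ k n e → 0ℤ + k * (n * e) ≡ n * (e * k)
  lemma = solve-∀

coprime⇒unit : ∀ {n q} → Coprime n q → ∃[ u ] u * + q ≡ 1ℤ mod n
coprime⇒unit {n} {q} coprime with coprime-Bézout coprime
... | Bézout.+- x y eq = - + y , modulo (- + x) (begin
  - + y * + q                     ≡⟨ lemma (+ y) (+ q) ⟩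
  1ℤ + - (1ℤ + + y * + q)         ≡⟨ cong (λ z → 1ℤ + - (1ℤ + z)) (ℤ.pos-* y q) ⟨
  1ℤ + - + (1 ℕ.+ y ℕ.* q)        ≡⟨ cong (λ z → 1ℤ + - + z) eq ⟩
  1ℤ + - + (x ℕ.* n)              ≡⟨ cong (λ z → 1ℤ + - z) (ℤ.pos-* x n) ⟩
  1ℤ + - (+ x * + n)              ≡⟨ cong (_+_ 1ℤ) (ℤ.neg-distribˡ-* (+ x) (+ n)) ⟩
  1ℤ + - + x * + n                ∎)
  where
  open ≡-Reasoning
  lemma : ∀ y q → - y * q ≡ 1ℤ + - (1ℤ + y * q)
  lemma = solve-∀
... | Bézout.-+ x y eq = + y , modulo (+ x) (begin
  + y * + q                       ≡⟨ ℤ.pos-* y q ⟨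
  + (y ℕ.* q)                     ≡⟨ cong +_ eq ⟨
  1ℤ + + (x ℕ.* n)                ≡⟨ cong (_+_ 1ℤ) (ℤ.pos-* x n) ⟩
  1ℤ + + x * + n                  ∎)
  where open ≡-Reasoning

mod-cancel : ∀ {n q a b} → Coprime n q → + q * a ≡ + q * b mod n → a ≡ b mod n
mod-cancel {n} {q} {a} {b} coprime qa≡qb with coprime⇒unit coprime
... | u , uq≡1 = begin
  a               ≡⟨ ℤ.*-identityˡ a ⟨
  1ℤ * a          ≈⟨ mod-*ʳ a uq≡1 ⟨
  u * + q * a     ≡⟨ ℤ.*-assoc u (+ q) a ⟩
  u * (+ q * a)   ≈⟨ mod-*ˡ u qa≡qb ⟩
  u * (+ q * b)   ≡⟨ ℤ.*-assoc u (+ q) b ⟨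
  u * + q * b     ≈⟨ mod-*ʳ b uq≡1 ⟩
  1ℤ * b          ≡⟨ ℤ.*-identityˡ b ⟩
  b               ∎
  where open mod-Reasoning n

coprime-* : ∀ {m n o} → Coprime m o → Coprime n o → Coprime (m ℕ.* n) o
coprime-* m⊥o n⊥o (d∣mn , d∣o) =
  -- A common divisor `d` of the product and `o` is prime to `m`, hence divides `n`.
  n⊥o (coprime-divisor (λ { (c∣d , c∣m) → m⊥o (c∣m , ∣-trans c∣d d∣o) }) d∣mn , d∣o)

coprime-^ : ∀ {m o} → Coprime m o → ∀ k → Coprime (m ℕ.^ k) o
coprime-^ m⊥o zero    (d∣1 , _) = ∣1⇒≡1 d∣1
coprime-^ {m} m⊥o (suc k) = coprime-* m⊥o (coprime-^ {m} m⊥o k)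

prime-coprime : ∀ {p m} → Prime p → ¬ p ∣ m → Coprime p m
prime-coprime p-prime p∤m (d∣p , d∣m) with prime⇒irreducible p-prime d∣p
... | inj₁ d≡1  = d≡1
... | inj₂ ≡.refl = contradiction d∣m p∤m

factor-out : ∀ {p c} → Prime p → .{{NonZero c}} → ∃[ j ] ∃[ m ] c ≡ m ℕ.* p ℕ.^ j × ¬ p ∣ m
factor-out {p} p-prime = go (<-wellFounded _)
  where
  instance
    _ = prime⇒nonZero p-prime
    _ = prime⇒nonTrivial p-prime
  go : ∀ {c} → .{{NonZero c}} → Acc ℕ._<_ c → ∃[ j ] ∃[ m ] c ≡ m ℕ.* p ℕ.^ j × ¬ p ∣ m
  go {c} (acc rec) with p ∣? c
  ... | no  p∤c = 0 , c , ≡.sym (ℕ.*-identityʳ c) , p∤c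
  ... | yes (divides c′@(suc _) ≡.refl) with go (rec (ℕ.m<m*n c′ p (ℕ.nonTrivial⇒n>1 p)))
  ...   | j , m , eq , p∤m = suc j , m , ≡.trans (cong (ℕ._* p) eq) (lemma m p (p ℕ.^ j)) , p∤m
    where
    lemma : ∀ m p x → m ℕ.* x ℕ.* p ≡ m ℕ.* (p ℕ.* x)
    lemma = ℕ-Solver.solve-∀

ι : ℤ → ℚ
ι k = k ℚ./ 1

private
  -- For a variable `k` the fraction `k / 1` is stuck on a gcd. This normal form computes, so sums
  -- and products of integers can be compared.
  integer : ℤ → ℚ
  integer k = mkℚ k 0 (λ { (_ , d∣1) → ∣1⇒≡1 d∣1 })

  ι≡integer : ∀ k → ι k ≡ integer k
  ι≡integer k = ℚ.↥p/↧p≡p (integer k)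

ι-+ : ∀ a b → ι (a + b) ≡ ι a ℚ.+ ι b
ι-+ a b = ≡.trans (cong ι (lemma a b)) (≡.sym (cong₂ ℚ._+_ (ι≡integer a) (ι≡integer b)))
  where
  lemma : ∀ a b → a + b ≡ a * + 1 + b * + 1
  lemma = solve-∀

ι-* : ∀ a b → ι (a * b) ≡ ι a ℚ.* ι b
ι-* a b = ≡.sym (cong₂ ℚ._*_ (ι≡integer a) (ι≡integer b))

ι-neg : ∀ a → ι (- a) ≡ ℚ.- ι a
ι-neg a = ≡.trans (ι≡integer (- a)) (≡.trans (neg a) (cong (ℚ.-_) (≡.sym (ι≡integer a))))
  where
  neg : ∀ a → integer (- a) ≡ ℚ.- integer a
  neg (+ zero)    = ≡.refl
  neg (+ suc _)   = ≡.refl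
  neg ℤ.-[1+ _ ] = ≡.refl

ι-injective : ∀ {a b} → ι a ≡ ι b → a ≡ b
ι-injective {a} {b} eq =
  proj₁ (ℚ.mkℚ-injective (≡.trans (≡.sym (ι≡integer a)) (≡.trans eq (ι≡integer b))))

/-*-cancel : ∀ k n .{{_ : NonZero n}} → (k ℚ./ n) ℚ.* ι (+ n) ≡ ι k
/-*-cancel k n@(suc n-1) = ℚ.toℚᵘ-injective (begin
  ℚ.toℚᵘ ((k ℚ./ n) ℚ.* ι (+ n))
    ≈⟨ ℚ.toℚᵘ-homo-* (k ℚ./ n) (ι (+ n)) ⟩
  ℚ.toℚᵘ (k ℚ./ n) ℚᵘ.* ℚ.toℚᵘ (ι (+ n))
    ≈⟨ ℚᵘ.*-cong (ℚ.toℚᵘ-fromℚᵘ (ℚᵘ.mkℚᵘ k n-1)) (ℚ.toℚᵘ-fromℚᵘ (ℚᵘ.mkℚᵘ (+ n) 0)) ⟩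
  ℚᵘ.mkℚᵘ k n-1 ℚᵘ.* ℚᵘ.mkℚᵘ (+ n) 0
    ≈⟨ ℚᵘ.*≡* (≡.trans (ℤ.*-identityʳ (k * + n)) (cong (λ x → k * + x) (≡.sym (ℕ.*-identityʳ n)))) ⟩
  ℚᵘ.mkℚᵘ k 0
    ≈⟨ ℚ.toℚᵘ-fromℚᵘ (ℚᵘ.mkℚᵘ k 0) ⟨
  ℚ.toℚᵘ (ι k) ∎)
  where open SetoidReasoning ℚᵘ.≃-setoid

module _ where
  open ℚ-Solver.+-*-Solver using (solve; _:=_; _:+_; _:*_; _:-_; :-_)

  mod-ℤ-reflexive : ∀ {p q} → p ≡ q → p ≡ q mod-ℤ
  mod-ℤ-reflexive {p} ≡.refl = 0ℤ , ℚ.+-inverseʳ p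

  mod-ℤ-sym : ∀ {p q} → p ≡ q mod-ℤ → q ≡ p mod-ℤ
  mod-ℤ-sym {p} {q} (k , eq) = - k ,
    ≡.trans (solve 2 (λ p q → q :- p := :- (p :- q)) ≡.refl p q)
      (≡.trans (cong ℚ.-_ eq) (≡.sym (ι-neg k)))

  mod-ℤ-trans : ∀ {p q r} → p ≡ q mod-ℤ → q ≡ r mod-ℤ → p ≡ r mod-ℤ
  mod-ℤ-trans {p} {q} {r} (k , eq) (l , eq′) = k + l ,
    ≡.trans (solve 3 (λ p q r → p :- r := (p :- q) :+ (q :- r)) ≡.refl p q r)
      (≡.trans (cong₂ ℚ._+_ eq eq′) (≡.sym (ι-+ k l)))

  mod-ℤ-+ : ∀ {p q r s} → p ≡ q mod-ℤ → r ≡ s mod-ℤ → p ℚ.+ r ≡ q ℚ.+ s mod-ℤ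
  mod-ℤ-+ {p} {q} {r} {s} (k , eq) (l , eq′) = k + l ,
    ≡.trans (solve 4 (λ p q r s → (p :+ r) :- (q :+ s) := (p :- q) :+ (r :- s)) ≡.refl p q r s)
      (≡.trans (cong₂ ℚ._+_ eq eq′) (≡.sym (ι-+ k l)))

  -- Clearing the common denominator `n` turns equality in ℚ/ℤ into a congruence of numerators;
  -- `mod⇒mod-ℤ` is the way back.
  mod-ℤ⇒mod : ∀ {n p q a b} → p ℚ.* ι (+ n) ≡ ι a → q ℚ.* ι (+ n) ≡ ι b → p ≡ q mod-ℤ → a ≡ b mod n
  mod-ℤ⇒mod {n} {p} {q} {a} {b} pn≡a qn≡b (k , eq) = modulo k (ι-injective (begin
    ι a                                 ≡⟨ pn≡a ⟨
    p ℚ.* ι (+ n)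
      ≡⟨ solve 3 (λ p q n → p :* n := q :* n :+ (p :- q) :* n) ≡.refl p q (ι (+ n)) ⟩
    q ℚ.* ι (+ n) ℚ.+ (p ℚ.- q) ℚ.* ι (+ n)
      ≡⟨ cong₂ (λ x y → x ℚ.+ y ℚ.* ι (+ n)) qn≡b eq ⟩
    ι b ℚ.+ ι k ℚ.* ι (+ n)             ≡⟨ cong (ι b ℚ.+_) (ι-* k (+ n)) ⟨
    ι b ℚ.+ ι (k * + n)                 ≡⟨ ι-+ b (k * + n) ⟨
    ι (b + k * + n)                     ∎))
    where open ≡-Reasoning

  mod⇒mod-ℤ : ∀ {n p q a b} .{{_ : NonZero n}} →
              p ℚ.* ι (+ n) ≡ ι a → q ℚ.* ι (+ n) ≡ ι b → a ≡ b mod n → p ≡ q mod-ℤ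
  mod⇒mod-ℤ {n} {p} {q} {a} {b} pn≡a qn≡b (modulo k eq) = k ,
    ≡.trans (lemma (p ℚ.- q)) (≡.trans (cong (ℚ._* (+ 1 ℚ./ n)) multiple) (≡.sym (lemma (ι k))))
    where
    open ≡-Reasoning
    inverse : (+ 1 ℚ./ n) ℚ.* ι (+ n) ≡ ι (+ 1)
    inverse = /-*-cancel (+ 1) n
    lemma : ∀ x → x ≡ x ℚ.* ι (+ n) ℚ.* (+ 1 ℚ./ n)
    lemma x = begin
      x                                 ≡⟨ ℚ.*-identityʳ x ⟨
      x ℚ.* ι (+ 1)                     ≡⟨ cong (x ℚ.*_) inverse ⟨
      x ℚ.* ((+ 1 ℚ./ n) ℚ.* ι (+ n))
        ≡⟨ solve 3 (λ x i n → x :* (i :* n) := x :* n :* i) ≡.refl x (+ 1 ℚ./ n) (ι (+ n)) ⟩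
      x ℚ.* ι (+ n) ℚ.* (+ 1 ℚ./ n)     ∎
    multiple : (p ℚ.- q) ℚ.* ι (+ n) ≡ ι k ℚ.* ι (+ n)
    multiple = begin
      (p ℚ.- q) ℚ.* ι (+ n)
        ≡⟨ solve 3 (λ p q n → (p :- q) :* n := p :* n :- q :* n) ≡.refl p q (ι (+ n)) ⟩
      p ℚ.* ι (+ n) ℚ.- q ℚ.* ι (+ n)   ≡⟨ cong₂ ℚ._-_ pn≡a qn≡b ⟩
      ι a ℚ.- ι b                       ≡⟨ cong (λ x → ι x ℚ.- ι b) eq ⟩
      ι (b + k * + n) ℚ.- ι b           ≡⟨ cong (ℚ._- ι b) (ι-+ b (k * + n)) ⟩
      ι b ℚ.+ ι (k * + n) ℚ.- ι b
        ≡⟨ solve 2 (λ b x → b :+ x :- b := x) ≡.refl (ι b) (ι (k * + n)) ⟩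
      ι (k * + n)                       ≡⟨ ι-* k (+ n) ⟩
      ι k ℚ.* ι (+ n)                   ∎

-- Diagonalising the pairing

module Diagonal {c ℓ} (Γ : GroupWithPairing c ℓ) where
  open GroupWithPairing Γ renaming (order to N)
  open Mult commutativeMonoid renaming (_×_ to _·_)
  open Sum commutativeMonoid
    using (sum-permute; sum-cong-≋; sum-replicate) renaming (sum to ∑; ∑-distrib-+ to ∑-distrib-∙)
  open GroupProperties group using (∙-cancelʳ; //-rightDividesˡ)
  open Inverse finite using (to; from; to-cong; strictlyInverseˡ; strictlyInverseʳ)
  module ≈-Reasoning = SetoidReasoning setoid

  instance
    N≢0 : NonZero N
    N≢0 = nonempty (to ε)
      where
      nonempty : ∀ {n} → Fin n → NonZero n
      nonempty {suc _} _ = _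

  infix 4 _≈?_
  _≈?_ : ∀ x y → Dec (x ≈ y)
  x ≈? y = Dec.map′
    (λ eq → trans (sym (strictlyInverseʳ x)) (trans (reflexive (cong from eq)) (strictlyInverseʳ y)))
    to-cong (to x ≟ to y)

  -- Finiteness supplies the instances of excluded middle that the classical argument uses.
  search : ∀ {r} {R : Carrier → Set r} → (∀ {x y} → x ≈ y → R x → R y) → (∀ x → Dec (R x)) → Dec (∃ R)
  search resp R? = Dec.map′ (λ (i , Ri) → from i , Ri)
    (λ (x , Rx) → to x , resp (sym (strictlyInverseʳ x)) Rx) (any? (R? ∘ from))

  -- Translation by x permutes the group, so Σ g = Σ (x ∙ g).
  lagrange : ∀ x → N · x ≈ ε
  lagrange x = ∙-cancelʳ (∑ from) (N · x) ε (begin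
    N · x ∙ ∑ from                   ≈⟨ ∙-congʳ (sum-replicate N) ⟨
    ∑ {N} (λ _ → x) ∙ ∑ from         ≈⟨ ∑-distrib-∙ (λ _ → x) from ⟨
    ∑ (λ i → x ∙ from i)             ≈⟨ sum-cong-≋ (λ i → strictlyInverseʳ (x ∙ from i)) ⟨
    ∑ (λ i → from (to (x ∙ from i))) ≈⟨ sum-permute from translation ⟨
    ∑ from                           ≈⟨ identityˡ (∑ from) ⟨
    ε ∙ ∑ from                       ∎)
    where
    open ≈-Reasoning
    cancel : ∀ y z → y ∙ z ≈ ε → ∀ i → to (y ∙ from (to (z ∙ from i))) ≡ i
    cancel y z yz≈ε i = ≡.trans (to-cong (begin
      y ∙ from (to (z ∙ from i)) ≈⟨ ∙-congˡ (strictlyInverseʳ (z ∙ from i)) ⟩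
      y ∙ (z ∙ from i)           ≈⟨ assoc y z (from i) ⟨
      y ∙ z ∙ from i             ≈⟨ ∙-congʳ yz≈ε ⟩
      ε ∙ from i                 ≈⟨ identityˡ (from i) ⟩
      from i                     ∎)) (strictlyInverseˡ i)
    translation : Permutation N N
    translation = permutation (λ i → to (x ∙ from i)) (λ i → to (x ⁻¹ ∙ from i))
      (cancel x (x ⁻¹) (inverseʳ x)) (cancel (x ⁻¹) x (inverseˡ x))

  -- By bilinearity the value equals its own double.
  ⟨ε,_⟩ : ∀ y → ⟨ ε , y ⟩ ≡ 0ℚ mod-ℤ
  ⟨ε, y ⟩ = - proj₁ doubled , (begin
    ⟨ ε , y ⟩ ℚ.- 0ℚ                                 ≡⟨ ℚ.+-identityʳ ⟨ ε , y ⟩ ⟩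
    ⟨ ε , y ⟩
      ≡⟨ solve 1 (λ p → p := :- (p :- (p :+ p))) ≡.refl ⟨ ε , y ⟩ ⟩
    ℚ.- (⟨ ε , y ⟩ ℚ.- (⟨ ε , y ⟩ ℚ.+ ⟨ ε , y ⟩))    ≡⟨ cong ℚ.-_ (proj₂ doubled) ⟩
    ℚ.- ι (proj₁ doubled)                            ≡⟨ ι-neg (proj₁ doubled) ⟨
    ι (- proj₁ doubled)                              ∎)
    where
    open ≡-Reasoning
    open ℚ-Solver.+-*-Solver using (solve; _:=_; _:+_; _:-_; :-_)
    doubled : ⟨ ε , y ⟩ ≡ ⟨ ε , y ⟩ ℚ.+ ⟨ ε , y ⟩ mod-ℤ
    doubled = mod-ℤ-trans {⟨ ε , y ⟩} {⟨ ε ∙ ε , y ⟩} {⟨ ε , y ⟩ ℚ.+ ⟨ ε , y ⟩}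
      (⟨,⟩-cong (sym (identityˡ ε)) refl) (bilinearˡ ε ε y)

  ⟨·,⟩ : ∀ m x y → ⟨ m · x , y ⟩ ≡ ⟨ x , y ⟩ ℚ.* ι (+ m) mod-ℤ
  ⟨·,⟩ zero x y = subst (⟨ ε , y ⟩ ≡_mod-ℤ) (≡.sym (ℚ.*-zeroʳ ⟨ x , y ⟩)) ⟨ε, y ⟩
  ⟨·,⟩ (suc m) x y = subst (⟨ suc m · x , y ⟩ ≡_mod-ℤ) (begin
      p ℚ.+ p ℚ.* ι (+ m)          ≡⟨ cong (ℚ._+ p ℚ.* ι (+ m)) (ℚ.*-identityʳ p) ⟨
      p ℚ.* ι 1ℤ ℚ.+ p ℚ.* ι (+ m) ≡⟨ ℚ.*-distribˡ-+ p (ι 1ℤ) (ι (+ m)) ⟨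
      p ℚ.* (ι 1ℤ ℚ.+ ι (+ m))     ≡⟨ cong (p ℚ.*_) (ι-+ 1ℤ (+ m)) ⟨
      p ℚ.* ι (+ suc m)            ∎)
    (mod-ℤ-trans {⟨ suc m · x , y ⟩} {p ℚ.+ ⟨ m · x , y ⟩} {p ℚ.+ p ℚ.* ι (+ m)}
      (bilinearˡ x (m · x) y)
      (mod-ℤ-+ {p} {p} {⟨ m · x , y ⟩} {p ℚ.* ι (+ m)} (mod-ℤ-reflexive {p} {p} ≡.refl) (⟨·,⟩ m x y)))
    where
    open ≡-Reasoning
    p : ℚ
    p = ⟨ x , y ⟩

  -- Since `N` kills `x`, it is a common denominator of all values of the pairing.
  integral : ∀ x y → ∃[ k ] ⟨ x , y ⟩ ℚ.* ι (+ N) ≡ ι k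
  integral x y = proj₁ vanishes ,
    ≡.trans (≡.sym (ℚ.+-identityʳ (⟨ x , y ⟩ ℚ.* ι (+ N)))) (proj₂ vanishes)
    where
    vanishes : ⟨ x , y ⟩ ℚ.* ι (+ N) ≡ 0ℚ mod-ℤ
    vanishes = mod-ℤ-trans {⟨ x , y ⟩ ℚ.* ι (+ N)} {⟨ N · x , y ⟩} {0ℚ}
      (mod-ℤ-sym {⟨ N · x , y ⟩} {⟨ x , y ⟩ ℚ.* ι (+ N)} (⟨·,⟩ N x y))
      (mod-ℤ-trans {⟨ N · x , y ⟩} {⟨ ε , y ⟩} {0ℚ} (⟨,⟩-cong (lagrange x) refl) ⟨ε, y ⟩)

  -- abstract: unfolding the rational arithmetic is slow, and ⟨ x , y ⟩ = B x y / N is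
  -- all that is needed
  abstract
    B : Carrier → Carrier → ℤ
    B x y = proj₁ (integral x y)

    B-spec : ∀ x y → ⟨ x , y ⟩ ℚ.* ι (+ N) ≡ ι (B x y)
    B-spec x y = proj₂ (integral x y)

  B-cong : ∀ {x x′ y y′} → x ≈ x′ → y ≈ y′ → B x y ≡ B x′ y′ mod N
  B-cong {x} {x′} {y} {y′} p q =
    mod-ℤ⇒mod {p = ⟨ x , y ⟩} {⟨ x′ , y′ ⟩} (B-spec x y) (B-spec x′ y′) (⟨,⟩-cong p q)

  B-sym : ∀ x y → B x y ≡ B y x mod N
  B-sym x y = mod-ℤ⇒mod {p = ⟨ x , y ⟩} {⟨ y , x ⟩} (B-spec x y) (B-spec y x) (symmetric x y)

  B-∙ˡ : ∀ x y z → B (x ∙ y) z ≡ B x z + B y z mod N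
  B-∙ˡ x y z = mod-ℤ⇒mod {p = ⟨ x ∙ y , z ⟩} {⟨ x , z ⟩ ℚ.+ ⟨ y , z ⟩} (B-spec (x ∙ y) z)
    (≡.trans (ℚ.*-distribʳ-+ (ι (+ N)) ⟨ x , z ⟩ ⟨ y , z ⟩)
      (≡.trans (cong₂ ℚ._+_ (B-spec x z) (B-spec y z)) (≡.sym (ι-+ (B x z) (B y z)))))
    (bilinearˡ x y z)

  B-nondegenerate : ∀ x → (∀ y → B x y ≡ 0ℤ mod N) → x ≈ ε
  B-nondegenerate x Bx≡0 = nondegenerate x λ y →
    mod⇒mod-ℤ {p = ⟨ x , y ⟩} {0ℚ} (B-spec x y) (ℚ.*-zeroˡ (ι (+ N))) (Bx≡0 y)

  B-εˡ : ∀ y → B ε y ≡ 0ℤ mod N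
  B-εˡ y = mod-ℤ⇒mod {p = ⟨ ε , y ⟩} {0ℚ} (B-spec ε y) (ℚ.*-zeroˡ (ι (+ N))) ⟨ε, y ⟩

  B-·ˡ : ∀ m x y → B (m · x) y ≡ + m * B x y mod N
  B-·ˡ m x y =
    mod-ℤ⇒mod {p = ⟨ m · x , y ⟩} {⟨ x , y ⟩ ℚ.* ι (+ m)} (B-spec (m · x) y) scaled (⟨·,⟩ m x y)
    where
    scaled : ⟨ x , y ⟩ ℚ.* ι (+ m) ℚ.* ι (+ N) ≡ ι (+ m * B x y)
    scaled = ≡.trans
      (solve 3 (λ p m n → p :* m :* n := m :* (p :* n)) ≡.refl ⟨ x , y ⟩ (ι (+ m)) (ι (+ N)))
      (≡.trans (cong (ι (+ m) ℚ.*_) (B-spec x y)) (≡.sym (ι-* (+ m) (B x y))))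
      where open ℚ-Solver.+-*-Solver using (solve; _:=_; _:*_)

  B-⁻¹ˡ : ∀ x y → B (x ⁻¹) y ≡ - B x y mod N
  B-⁻¹ˡ x y = begin
    B (x ⁻¹) y                    ≡⟨ lemma (B (x ⁻¹) y) (B x y) ⟩
    B (x ⁻¹) y + B x y + - B x y  ≈⟨ mod-+ (mod-trans (mod-sym (B-∙ˡ (x ⁻¹) x y))
                                       (mod-trans (B-cong (inverseˡ x) refl) (B-εˡ y))) (mod-reflexive ≡.refl) ⟩
    0ℤ + - B x y                  ≡⟨ ℤ.+-identityˡ (- B x y) ⟩
    - B x y ∎
    where
    open mod-Reasoning N
    lemma : ∀ a b → a ≡ a + b + - b
    lemma = solve-∀

  B-flip : ∀ {x y k} → B y x ≡ k mod N → B x y ≡ k mod N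
  B-flip {x} {y} = mod-trans (B-sym x y)

  B-∙ʳ : ∀ x y z → B x (y ∙ z) ≡ B x y + B x z mod N
  B-∙ʳ x y z = B-flip (mod-trans (B-∙ˡ y z x) (mod-+ (B-sym y x) (B-sym z x)))

  B-·ʳ : ∀ m x y → B x (m · y) ≡ + m * B x y mod N
  B-·ʳ m x y = B-flip (mod-trans (B-·ˡ m y x) (mod-*ˡ (+ m) (B-sym y x)))

  B-⁻¹ʳ : ∀ x y → B x (y ⁻¹) ≡ - B x y mod N
  B-⁻¹ʳ x y = B-flip (mod-trans (B-⁻¹ˡ y x) (mod-neg (B-sym y x)))

  B-εʳ : ∀ x → B x ε ≡ 0ℤ mod N
  B-εʳ x = B-flip (B-εˡ x)

  B-∑ˡ : ∀ {k} (t : Fin k → ℕ) (x : Fin k → Carrier) y →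
         B (∑ (λ i → t i · x i)) y ≡ sum (λ i → + t i * B (x i) y) mod N
  B-∑ˡ {zero}  t x y = B-εˡ y
  B-∑ˡ {suc k} t x y = mod-trans (B-∙ˡ _ _ y)
    (mod-+ (B-·ˡ (t zero) (x zero) y) (B-∑ˡ (t ∘ suc) (x ∘ suc) y))

  -- A decidable subgroup on which the restricted pairing is non-degenerate. Being a predicate
  -- rather than a group of its own, it shares `B` and the modulus `N` with Γ.
  record Nondegenerate (P : Carrier → Set) : Set (c ⊔ ℓ) where
    field
      P?    : ∀ x → Dec (P x)
      resp  : ∀ {x y} → x ≈ y → P x → P y
      ε∈    : P ε
      ∙∈    : ∀ {x y} → P x → P y → P (x ∙ y)
      ⁻¹∈   : ∀ {x} → P x → P (x ⁻¹)
      nondeg : ∀ {x} → P x → (∀ {y} → P y → B x y ≡ 0ℤ mod N) → x ≈ ε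

    ·∈ : ∀ m {x} → P x → P (m · x)
    ·∈ zero    x∈P = ε∈
    ·∈ (suc m) x∈P = ∙∈ x∈P (·∈ m x∈P)

  whole : Nondegenerate (λ _ → ⊤)
  whole = record
    { P? = λ _ → yes tt ; resp = _ ; ε∈ = tt ; ∙∈ = _ ; ⁻¹∈ = _
    ; nondeg = λ {x} _ Bx≡0 → B-nondegenerate x (λ y → Bx≡0 tt) }

  infix 6 _⊥_
  _⊥_ : (Carrier → Set) → Carrier → Carrier → Set
  (P ⊥ x) y = P y × B x y ≡ 0ℤ mod N

  -- With `e` = N / n, `square` says that the generator pairs with itself to q / n. The field
  -- `anisotropic` makes the passage to the orthogonal complement a strict descent.
  record Generator (P : Carrier → Set) : Set (c ⊔ ℓ) where
    field
      generator   : Carrier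
      generator∈P : P generator
      n e q       : ℕ
      n*e≡N       : n ℕ.* e ≡ N
      n⊥q         : Coprime n q
      anisotropic : ¬ (B generator generator ≡ 0ℤ mod N)
      n·≈ε        : n · generator ≈ ε
      square      : B generator generator ≡ + e * + q mod N

  module CyclicSummand (odd : OddOrder Γ) {P : Carrier → Set} (S : Nondegenerate P) where
    open Nondegenerate S

    cancel-2 : ∀ {a} → + 2 * a ≡ 0ℤ mod N → a ≡ 0ℤ mod N
    cancel-2 2a≡0 = mod-cancel {q = 2}
      (coprime-sym (prime-coprime prime[2] odd)) 2a≡0

    -- Expanding `B` at (x ∙ y, x ∙ y) shows that 2 c B x y vanishes for every `y` in `P`. As `N` is
    -- odd the 2 cancels, and non-degeneracy on `P` applies to `c · x`.
    polarize : ∀ c → (∀ {x} → P x → + c * B x x ≡ 0ℤ mod N) → ∀ {x} → P x → c · x ≈ ε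
    polarize c cB≡0 {x} x∈P = nondeg (·∈ c x∈P) λ {y} y∈P →
      mod-trans (B-·ˡ c x y) (cancel-2 (begin
        + 2 * (+ c * B x y)
          ≡⟨ lemma (+ c) (B x y) ⟩
        0ℤ + + c * B x y + (+ c * B x y + 0ℤ)
          ≈⟨ mod-+ (mod-+ (cB≡0 x∈P) (mod-reflexive ≡.refl))
                   (mod-+ (mod-*ˡ (+ c) (B-sym y x)) (cB≡0 y∈P)) ⟨
        + c * B x x + + c * B x y + (+ c * B y x + + c * B y y)
          ≡⟨ expand (+ c) (B x x) (B x y) (B y x) (B y y) ⟩
        + c * (B x x + B x y + (B y x + B y y))
          ≈⟨ mod-*ˡ (+ c) (mod-trans (B-∙ˡ x y (x ∙ y)) (mod-+ (B-∙ʳ x x y) (B-∙ʳ y x y))) ⟨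
        + c * B (x ∙ y) (x ∙ y)
          ≈⟨ cB≡0 (∙∈ x∈P y∈P) ⟩
        0ℤ ∎))
      where
      open mod-Reasoning N
      lemma : ∀ c b → + 2 * (c * b) ≡ 0ℤ + c * b + (c * b + 0ℤ)
      lemma = solve-∀
      expand : ∀ c p q r s → c * p + c * q + (c * r + c * s) ≡ c * (p + q + (r + s))
      expand = solve-∀

    -- The contrapositive of `polarize`; the witness comes from an exhaustive search.
    non-isotropic : ∀ c {x} → P x → ¬ c · x ≈ ε → ∃[ y ] P y × ¬ (+ c * B y y ≡ 0ℤ mod N)
    non-isotropic c x∈P cx≉ε = Dec.decidable-stable
      (search {R = λ y → P y × ¬ (+ c * B y y ≡ 0ℤ mod N)}
        (λ y≈z (y∈P , cB≢0) → resp y≈z y∈P ,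
          λ cB≡0 → cB≢0 (mod-trans (mod-*ˡ (+ c) (B-cong y≈z y≈z)) cB≡0))
        (λ y → P? y ×-dec ¬? (+ c * B y y ≡? 0ℤ mod N)))
      (λ none → cx≉ε (polarize c
        (λ {y} y∈P → Dec.decidable-stable (+ c * B y y ≡? 0ℤ mod N)
          (λ cB≢0 → none (y , y∈P , cB≢0))) x∈P))

    -- Then `p` divides the exponent of `P`, and exactly as often as it divides `p ℕ.* d`.
    record ExponentPrime : Set (c ⊔ ℓ) where
      field
        p d f    : ℕ
        p-prime  : Prime p
        f*pd≡N   : f ℕ.* (p ℕ.* d) ≡ N
        pd-kills : ∀ {y} → P y → (p ℕ.* d) · y ≈ ε
        survivor : ∃[ y ] P y × ¬ d · y ≈ ε

    -- Prime factors of a multiple of the exponent are dropped one at a time as long as the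
    -- remaining product still kills `P`. This stops before the product is 1, because `P` is not
    -- trivial. The dropped factors collect in `f`.
    exponent-prime : (∃[ y ] P y × ¬ y ≈ ε) → ∀ f (ps : List ℕ) → All Prime ps → f ℕ.* product ps ≡ N →
      (∀ {y} → P y → product ps · y ≈ ε) → ExponentPrime
    exponent-prime (_ , x∈P , x≉ε) f [] _ _ kills =
      contradiction (trans (sym (×-homo-1 _)) (kills x∈P)) x≉ε
    exponent-prime nontrivial f (p ∷ ps) (p-prime ∷ ps-prime) eq kills = decide
      (search (λ y≈z (y∈P , y≉) → resp y≈z y∈P , λ z≈ → y≉ (trans (×-congʳ (product ps) y≈z) z≈))
              (λ y → P? y ×-dec ¬? (product ps · y ≈? ε)))
      where
      decide : Dec (∃[ y ] P y × ¬ product ps · y ≈ ε) → ExponentPrime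
      decide (yes survivor) = record
        { p = p ; d = product ps ; f = f ; p-prime = p-prime ; f*pd≡N = eq
        ; pd-kills = kills ; survivor = survivor }
      decide (no none) = exponent-prime nontrivial (f ℕ.* p) ps ps-prime
        (≡.trans (ℕ.*-assoc f p (product ps)) eq)
        (λ {y} y∈P → Dec.decidable-stable (product ps · y ≈? ε) (λ y≉ → none (y , y∈P , y≉)))

    prime-power-generator : ExponentPrime → Generator P
    prime-power-generator E = record
      { generator   = g
      ; generator∈P = ·∈ m x∈P
      ; n           = n
      ; e           = e
      ; q           = q
      ; n*e≡N       = n*e≡N
      ; n⊥q         = coprime-^ {p} (prime-coprime p-prime p∤q) (suc j)
      ; anisotropic = λ Bgg≡0 → pʲBgg≢0
          (mod-trans (mod-*ˡ (+ pʲ) Bgg≡0) (mod-reflexive (ℤ.*-zeroʳ (+ pʲ))))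
      ; n·≈ε        = n·g≈ε
      ; square      = mod-trans (mod-reflexive Bgg≡eb) (mod-sym (mod-scale e n*e≡N (mod-% b)))
      }
      where
      open ExponentPrime E
      anisotropic-element : ∃[ x ] P x × ¬ (+ d * B x x ≡ 0ℤ mod N)
      anisotropic-element = non-isotropic d (proj₁ (proj₂ survivor)) (proj₂ (proj₂ survivor))
      x : Carrier
      x = proj₁ anisotropic-element
      x∈P : P x
      x∈P = proj₁ (proj₂ anisotropic-element)
      dBxx≢0 : ¬ (+ d * B x x ≡ 0ℤ mod N)
      dBxx≢0 = proj₂ (proj₂ anisotropic-element)
      d≢0 : d ≢ 0
      d≢0 d≡0 = proj₂ (proj₂ survivor) (×-congˡ d≡0)
      factored : ∃[ j ] ∃[ m ] d ≡ m ℕ.* p ℕ.^ j × ¬ p ∣ m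
      factored = factor-out p-prime {{ℕ.≢-nonZero d≢0}}
      j m : ℕ
      j = proj₁ factored
      m = proj₁ (proj₂ factored)
      d≡mpʲ : d ≡ m ℕ.* p ℕ.^ j
      d≡mpʲ = proj₁ (proj₂ (proj₂ factored))
      p∤m : ¬ p ∣ m
      p∤m = proj₂ (proj₂ (proj₂ factored))
      instance
        _ = prime⇒nonZero p-prime
        _ = ℕ.m^n≢0 p (suc j)
      pʲ n e : ℕ
      pʲ = p ℕ.^ j
      n = p ℕ.* pʲ
      -- Here N = f p d and d = m pʲ, so that n e = N.
      e = f ℕ.* m
      g : Carrier
      -- Multiplying by the part of `d` prime to `p` leaves an element killed by the power `n` of
      -- `p`.
      g = m · x
      n*e≡N : n ℕ.* e ≡ N
      n*e≡N = ≡.trans (rearrange p pʲ f m)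
        (≡.trans (cong (λ z → f ℕ.* (p ℕ.* z)) (≡.sym d≡mpʲ)) f*pd≡N)
        where
        rearrange : ∀ p x f m → p ℕ.* x ℕ.* (f ℕ.* m) ≡ f ℕ.* (p ℕ.* (m ℕ.* x))
        rearrange = ℕ-Solver.solve-∀
      n·g≈ε : n · g ≈ ε
      n·g≈ε = begin
        n · g                        ≈⟨ ×-assocˡ x n m ⟩
        (n ℕ.* m) · x
          ≈⟨ ×-congˡ (≡.trans (rearrange p pʲ m) (cong (p ℕ.*_) (≡.sym d≡mpʲ))) ⟩
        (p ℕ.* d) · x                ≈⟨ pd-kills x∈P ⟩
        ε                            ∎
        where
        open ≈-Reasoning
        rearrange : ∀ p x m → p ℕ.* x ℕ.* m ≡ p ℕ.* (m ℕ.* x)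
        rearrange = ℕ-Solver.solve-∀
      quotient : ∃[ b ] B g g ≡ + e * b
      quotient = exact-quotient {n = n} e n*e≡N
        (mod-trans (mod-sym (B-·ˡ n g g)) (mod-trans (B-cong n·g≈ε refl) (B-εˡ g)))
      b : ℤ
      b = proj₁ quotient
      Bgg≡eb : B g g ≡ + e * b
      Bgg≡eb = proj₂ quotient
      q : ℕ
      -- Only the class of `b` modulo `n` matters in ℚ/ℤ, and a resistance needs a numerator that is
      -- not negative.
      q = b ℤ.%ℕ n
      pdBxx≡0 : + p * (+ d * B x x) ≡ 0ℤ mod N
      pdBxx≡0 = begin
        + p * (+ d * B x x)    ≡⟨ ℤ.*-assoc (+ p) (+ d) (B x x) ⟨
        + p * + d * B x x      ≡⟨ cong (_* B x x) (ℤ.pos-* p d) ⟨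
        + (p ℕ.* d) * B x x    ≈⟨ B-·ˡ (p ℕ.* d) x x ⟨
        B ((p ℕ.* d) · x) x    ≈⟨ B-cong (pd-kills x∈P) refl ⟩
        B ε x                  ≈⟨ B-εˡ x ⟩
        0ℤ                     ∎
        where open mod-Reasoning N
      -- Let v = d B x x. As g = m x, the number pʲ B g g is congruent to m v, while p v vanishes
      -- because `p ℕ.* d` kills `x`. If m v vanished too, then so would v, since m and p are
      -- coprime.
      pʲBgg≢0 : ¬ (+ pʲ * B g g ≡ 0ℤ mod N)
      pʲBgg≢0 pʲBgg≡0 = dBxx≢0 (combine (coprime⇒unit (prime-coprime p-prime p∤m)))
        where
        open mod-Reasoning N
        v : ℤ
        v = + d * B x x
        rearrange : ∀ m x b → m * (m * x * b) ≡ x * (m * (m * b))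
        rearrange = solve-∀
        mv≡0 : + m * v ≡ 0ℤ mod N
        mv≡0 = begin
          + m * (+ d * B x x)
            ≡⟨ cong (λ z → + m * (z * B x x)) (≡.trans (cong +_ d≡mpʲ) (ℤ.pos-* m pʲ)) ⟩
          + m * (+ m * + pʲ * B x x)      ≡⟨ rearrange (+ m) (+ pʲ) (B x x) ⟩
          + pʲ * (+ m * (+ m * B x x))
            ≈⟨ mod-*ˡ (+ pʲ) (mod-trans (B-·ˡ m x g) (mod-*ˡ (+ m) (B-·ʳ m x x))) ⟨
          + pʲ * B g g                    ≈⟨ pʲBgg≡0 ⟩
          0ℤ                              ∎
        combine : ∃[ u ] u * + m ≡ 1ℤ mod p → v ≡ 0ℤ mod N
        combine (u , modulo k um≡1+kp) = begin
          v                                ≡⟨ lemma v k (+ p) ⟩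
          (1ℤ + k * + p) * v + - k * (+ p * v)
                                           ≡⟨ cong (λ z → z * v + - k * (+ p * v)) um≡1+kp ⟨
          u * + m * v + - k * (+ p * v)    ≡⟨ cong (_+ - k * (+ p * v)) (ℤ.*-assoc u (+ m) v) ⟩
          u * (+ m * v) + - k * (+ p * v)  ≈⟨ mod-+ (mod-*ˡ u mv≡0) (mod-*ˡ (- k) pdBxx≡0) ⟩
          u * 0ℤ + - k * 0ℤ                ≡⟨ cong₂ _+_ (ℤ.*-zeroʳ u) (ℤ.*-zeroʳ (- k)) ⟩
          0ℤ                               ∎
          where
          lemma : ∀ v k p → v ≡ (1ℤ + k * p) * v + - k * (p * v)
          lemma = solve-∀
      -- If `p` divided `q` it would divide `b`, and pʲ B g g = pʲ e b would be a multiple of pʲ⁺¹ e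
      -- = N.
      p∤q : ¬ p ∣ q
      p∤q (divides a q≡ap) = pʲBgg≢0 (modulo (+ a + + pʲ * t) (begin
        + pʲ * B g g                          ≡⟨ cong (λ z → + pʲ * z) Bgg≡eb ⟩
        + pʲ * (+ e * b)
          ≡⟨ cong (λ z → + pʲ * (+ e * z)) (ℤ.a≡a%ℕn+[a/ℕn]*n b n) ⟩
        + pʲ * (+ e * (+ q + t * + n))        ≡⟨ cong₂ (λ y z → + pʲ * (+ e * (y + t * z)))
                                                   (≡.trans (cong +_ q≡ap) (ℤ.pos-* a p)) (ℤ.pos-* p pʲ) ⟩
        + pʲ * (+ e * (+ a * + p + t * (+ p * + pʲ)))
                                              ≡⟨ lemma (+ pʲ) (+ e) (+ a) (+ p) t ⟩
        0ℤ + (+ a + + pʲ * t) * (+ p * + pʲ * + e)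
                                              ≡⟨ cong (λ z → 0ℤ + (+ a + + pʲ * t) * z) N≡ ⟨
        0ℤ + (+ a + + pʲ * t) * + N           ∎))
        where
        open ≡-Reasoning
        t : ℤ
        t = b ℤ./ℕ n
        N≡ : + N ≡ + p * + pʲ * + e
        N≡ = ≡.trans (cong +_ (≡.sym n*e≡N)) (≡.trans (ℤ.pos-* n e) (cong (_* + e) (ℤ.pos-* p pʲ)))
        lemma : ∀ x e a p t → x * (e * (a * p + t * (p * x))) ≡ 0ℤ + (a + x * t) * (p * x * e)
        lemma = solve-∀

    generator : (∃[ y ] P y × ¬ y ≈ ε) → Generator P
    generator nontrivial = prime-power-generator (exponent-prime nontrivial 1 factors factorsPrime
      (≡.trans (ℕ.*-identityˡ (product factors)) (≡.sym isFactorisation))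
      (λ {y} _ → trans (×-congˡ (≡.sym isFactorisation)) (lagrange y)))
      where open PrimeFactorisation (factorise N)

  factorˡ : ∀ {n e} → n ℕ.* e ≡ N → NonZero n
  factorˡ {n} eq = ℕ.m*n≢0⇒m≢0 n {{subst NonZero (≡.sym eq) N≢0}}

  factorʳ : ∀ {n e} → n ℕ.* e ≡ N → NonZero e
  factorʳ {n} eq = ℕ.m*n≢0⇒n≢0 n {{subst NonZero (≡.sym eq) N≢0}}

  module Splitting (odd : OddOrder Γ) {P : Carrier → Set} (S : Nondegenerate P)
                   (G : Generator P) where
    open Nondegenerate S
    open Generator G renaming (generator to g; generator∈P to g∈P)

    instance
      n≢0 : NonZero n
      n≢0 = factorˡ n*e≡N

    -- Both sides are multiples of `e`, since `n` kills `g`. After division by `e` the equation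
    -- reads t q = b modulo `n`, and `q` is a unit there.
    projection : ∀ y → ∃[ t ] + t * B g g ≡ B g y mod N
    projection y = t , (begin
      + t * B g g           ≈⟨ mod-*ˡ (+ t) square ⟩
      + t * (+ e * + q)     ≡⟨ rearrange (+ t) (+ e) (+ q) ⟩
      + e * (+ t * + q)     ≈⟨ mod-scale e n*e≡N tq≡b ⟩
      + e * b               ≡⟨ proj₂ quotient ⟨
      B g y                 ∎)
      where
      open mod-Reasoning N
      rearrange : ∀ t e q → t * (e * q) ≡ e * (t * q)
      rearrange = solve-∀
      quotient : ∃[ b ] B g y ≡ + e * b
      quotient = exact-quotient {n = n} e n*e≡N
        (mod-trans (mod-sym (B-·ˡ n g y)) (mod-trans (B-cong n·≈ε refl) (B-εˡ y)))
      b : ℤ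
      b = proj₁ quotient
      unit : ∃[ u ] u * + q ≡ 1ℤ mod n
      unit = coprime⇒unit n⊥q
      u : ℤ
      u = proj₁ unit
      t : ℕ
      t = (u * b) ℤ.%ℕ n
      tq≡b : + t * + q ≡ b mod n
      tq≡b = mod-trans (mod-*ʳ (+ q) (mod-% (u * b)))
        (mod-trans (mod-reflexive (swap u b (+ q)))
          (mod-trans (mod-*ʳ b (proj₂ unit)) (mod-reflexive (ℤ.*-identityˡ b))))
        where
        swap : ∀ u b q → u * b * q ≡ u * q * b
        swap = solve-∀

    split : ∀ {y} → P y → ∃[ t ] ∃[ z ] (P ⊥ g) z × y ≈ t · g ∙ z
    split {y} y∈P = t , y ∙ (t · g) ⁻¹ , (∙∈ y∈P (⁻¹∈ (·∈ t g∈P)) , orthogonal) ,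
      sym (trans (comm (t · g) _) (//-rightDividesˡ (t · g) y))
      where
      open mod-Reasoning N
      t : ℕ
      t = proj₁ (projection y)
      orthogonal : B g (y ∙ (t · g) ⁻¹) ≡ 0ℤ mod N
      orthogonal = begin
        B g (y ∙ (t · g) ⁻¹)      ≈⟨ B-∙ʳ g y ((t · g) ⁻¹) ⟩
        B g y + B g ((t · g) ⁻¹)
          ≈⟨ mod-+ {a = B g y} (mod-reflexive ≡.refl) (mod-trans (B-⁻¹ʳ g (t · g)) (mod-neg
                                       (mod-trans (B-·ʳ t g g) (proj₂ (projection y))))) ⟩
        B g y + - B g y           ≡⟨ ℤ.+-inverseʳ (B g y) ⟩
        0ℤ                        ∎

    complement : Nondegenerate (P ⊥ g)
    complement = record
      { P?     = λ y → P? y ×-dec B g y ≡? 0ℤ mod N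
      ; resp   = λ y≈z (y∈P , g⊥y) → resp y≈z y∈P , mod-trans (B-cong refl (sym y≈z)) g⊥y
      ; ε∈     = ε∈ , B-εʳ g
      ; ∙∈     = λ {y} {z} (y∈P , g⊥y) (z∈P , g⊥z) → ∙∈ y∈P z∈P , mod-trans (B-∙ʳ g y z) (mod-+ g⊥y g⊥z)
      ; ⁻¹∈    = λ {y} (y∈P , g⊥y) → ⁻¹∈ y∈P , mod-trans (B-⁻¹ʳ g y) (mod-neg g⊥y)
      -- By `split`, an element orthogonal to both `g` and the complement is orthogonal to all of
      -- `P`.
      ; nondeg = λ {y} (y∈P , g⊥y) By≡0 → nondeg y∈P λ {w} w∈P → vanishes g⊥y By≡0 (split w∈P)
      }
      where
      vanishes : ∀ {y} → B g y ≡ 0ℤ mod N → (∀ {z} → (P ⊥ g) z → B y z ≡ 0ℤ mod N) →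
                 ∀ {w} → ∃[ t ] ∃[ z ] (P ⊥ g) z × w ≈ t · g ∙ z → B y w ≡ 0ℤ mod N
      vanishes {y} g⊥y By≡0 {w} (t , z , z∈ , w≈) = begin
        B y w                ≈⟨ mod-trans (B-cong refl w≈) (B-∙ʳ y (t · g) z) ⟩
        B y (t · g) + B y z
          ≈⟨ mod-+ (mod-trans (B-·ʳ t y g) (mod-*ˡ (+ t) (B-flip g⊥y))) (By≡0 z∈) ⟩
        + t * 0ℤ + 0ℤ        ≡⟨ cong (_+ 0ℤ) (ℤ.*-zeroʳ (+ t)) ⟩
        0ℤ                   ∎
        where open mod-Reasoning N

  -- The i-th basis element pairs with itself to num / ord, where `cofactor i` = N / ord.
  -- Independence is contained in `B-basis`, which determines each coordinate modulo its order.
  record OrthogonalBasis (P : Carrier → Set) : Set (c ⊔ ℓ) where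
    field
      rank       : ℕ
      orders     : Orders rank
      cofactor   : Fin rank → ℕ
      basis      : Fin rank → Carrier
      basis∈P    : ∀ i → P (basis i)
      ord*cofactor≡N : ∀ i → ord orders i ℕ.* cofactor i ≡ N
      ord⊥num    : ∀ i → Coprime (ord orders i) (num orders i)
      B-basis    : ∀ i j → B (basis i) (basis j) ≡ + δ i j * (+ cofactor j * + num orders j) mod N
      spans      : ∀ {y} → P y → Σ[ t ∈ (Fin rank → ℕ) ] y ≈ ∑ (λ i → t i · basis i)

  trivial-basis : ∀ {P} → (∀ {y} → P y → y ≈ ε) → OrthogonalBasis P
  trivial-basis trivial = record
    { rank           = 0
    ; orders         = []
    ; cofactor       = λ ()
    ; basis          = λ ()
    ; basis∈P        = λ ()
    ; ord*cofactor≡N = λ ()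
    ; ord⊥num        = λ ()
    ; B-basis        = λ ()
    ; spans          = λ y∈P → (λ ()) , trivial y∈P
    }

  extend-basis : ∀ odd {P} (S : Nondegenerate P) (G : Generator P) →
                 OrthogonalBasis (P ⊥ Generator.generator G) → OrthogonalBasis P
  extend-basis odd S G basis-⊥ = record
    { rank           = suc rank
    ; orders         = (n , q) ∷ orders
    ; cofactor       = e F.∷ cofactor
    ; basis          = g F.∷ basis
    ; basis∈P        = λ { zero → g∈P ; (suc i) → proj₁ (basis∈P i) }
    ; ord*cofactor≡N = λ { zero → n*e≡N ; (suc i) → ord*cofactor≡N i }
    ; ord⊥num        = λ { zero → n⊥q ; (suc i) → ord⊥num i }
    ; B-basis        = λ
      { zero    zero    → mod-trans square (mod-reflexive (≡.sym (ℤ.*-identityˡ (+ e * + q))))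
      ; zero    (suc j) → proj₂ (basis∈P j)
      ; (suc i) zero    → B-flip (proj₂ (basis∈P i))
      ; (suc i) (suc j) → B-basis i j
      }
    ; spans          = λ y∈P →
        let t , z , z∈ , y≈ = split y∈P
            s , z≈ = spans z∈
        in (t F.∷ s) , trans y≈ (∙-congˡ z≈)
    }
    where
    open Generator G renaming (generator to g; generator∈P to g∈P)
    open Splitting odd S G
    open OrthogonalBasis basis-⊥

  -- The list `l` contains the indices of all elements of `P`, and its length is the measure of the
  -- recursion. Passing to the complement of `g` filters it by orthogonality to `g`, which removes
  -- `g` itself.
  orthogonal-basis : OddOrder Γ → ∀ {P} → Nondegenerate P → ∀ l → (∀ {y} → P y → to y ∈ l) →
                     Acc ℕ._<_ (length l) → OrthogonalBasis P
  orthogonal-basis odd {P} S l enumerates (acc rec) = decide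
    (search (λ y≈z (y∈P , y≉ε) → resp y≈z y∈P , λ z≈ε → y≉ε (trans y≈z z≈ε))
            (λ y → P? y ×-dec ¬? (y ≈? ε)))
    where
    open Nondegenerate S
    recurse : (G : Generator P) → OrthogonalBasis P
    recurse G = extend-basis odd S G (orthogonal-basis odd complement (filter Q? l)
      (λ {y} (y∈P , g⊥y) → ∈-filter⁺ Q? (enumerates y∈P)
        (mod-trans (B-cong refl (strictlyInverseʳ y)) g⊥y))
      (rec shrinks))
      where
      open Generator G renaming (generator to g; generator∈P to g∈P)
      open Splitting odd S G using (complement)
      Q? : ∀ i → Dec (B g (from i) ≡ 0ℤ mod N)
      Q? i = B g (from i) ≡? 0ℤ mod N
      shrinks : length (filter Q? l) ℕ.< length l
      shrinks = filter-notAll Q? l (lose (enumerates g∈P)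
        (λ g⊥g → anisotropic (mod-trans (B-cong refl (sym (strictlyInverseʳ g))) g⊥g)))
    decide : Dec (∃[ y ] P y × ¬ y ≈ ε) → OrthogonalBasis P
    decide (yes nontrivial) = recurse (CyclicSummand.generator odd S nontrivial)
    decide (no none) = trivial-basis
      (λ {y} y∈P → Dec.decidable-stable (y ≈? ε) (λ y≉ε → none (y , y∈P , y≉ε)))

  whole-basis : OddOrder Γ → OrthogonalBasis (λ _ → ⊤)
  whole-basis odd = orthogonal-basis odd whole (allFin N) (λ {y} _ → ∈-allFin (to y)) (<-wellFounded _)

-- The isomorphism with the Jacobian

module Divisors (G : Graph) where
  open Graph G
  open Jacobian G

  div-0 : ∀ v → div (λ _ → 0ℤ) v ≡ 0ℤ
  div-0 v = sum-0 (λ w → ℤ.*-zeroʳ (+ edges v w))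

  div-linear : ∀ c f g v → div (λ w → c * f w + g w) v ≡ c * div f v + div g v
  div-linear c f g v = begin
    sum (λ w → + edges v w * (c * f v + g v - (c * f w + g w)))
      ≡⟨ sum-cong-≗ (λ w → lemma (+ edges v w) c (f v) (f w) (g v) (g w)) ⟩
    sum (λ w → c * (+ edges v w * (f v - f w)) + + edges v w * (g v - g w))
      ≡⟨ ∑-distrib-+ (λ w → c * (+ edges v w * (f v - f w))) (λ w → + edges v w * (g v - g w)) ⟩
    sum (λ w → c * (+ edges v w * (f v - f w))) + div g v
      ≡⟨ cong (_+ div g v) (*-distribˡ-sum c (λ w → + edges v w * (f v - f w))) ⟨
    c * div f v + div g v ∎
    where
    open ≡-Reasoning
    lemma : ∀ e c a b x y → e * (c * a + x - (c * b + y)) ≡ c * (e * (a - b)) + e * (x - y)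
    lemma = solve-∀

  div-combination : ∀ {k} (c : Fin k → ℤ) (f : Fin k → Vertex → ℤ) v →
    div (λ w → sum (λ i → c i * f i w)) v ≡ sum (λ i → c i * div (f i) v)
  div-combination {zero}  c f v = div-0 v
  div-combination {suc k} c f v = ≡.trans
    (div-linear (c zero) (f zero) (λ w → sum (λ i → c (suc i) * f (suc i) w)) v)
    (cong (_+_ (c zero * div (f zero) v)) (div-combination (c ∘ suc) (f ∘ suc) v))

  -- The graph Laplacian is symmetric. Adding the off-diagonal sum of edges w v g v f w to either
  -- side leaves the diagonal sum, in which g w f w is weighted by the valency of `w`.
  div-self-adjoint : ∀ g f → sum (λ w → div g w * f w) ≡ sum (λ w → g w * div f w)
  div-self-adjoint g f =
    GroupProperties.∙-cancelʳ (AbelianGroup.group ℤ.+-0-abelianGroup) (sum (λ w → sum (cross w))) _ _ (begin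
    sum (λ w → div g w * f w) + sum (λ w → sum (cross w))
      ≡⟨ ∑-distrib-+ (λ w → div g w * f w) (λ w → sum (cross w)) ⟨
    sum (λ w → div g w * f w + sum (cross w))
      ≡⟨ sum-cong-≗ left ⟩
    sum (λ w → sum (λ v → + edges w v * g w * f w))
      ≡⟨ sum-cong-≗ right ⟨
    sum (λ w → g w * div f w + sum (λ v → cross v w))
      ≡⟨ ∑-distrib-+ (λ w → g w * div f w) (λ w → sum (λ v → cross v w)) ⟩
    sum (λ w → g w * div f w) + sum (λ w → sum (λ v → cross v w))
      ≡⟨ cong (_+_ (sum (λ w → g w * div f w))) (∑-comm cross) ⟨
    sum (λ w → g w * div f w) + sum (λ w → sum (cross w)) ∎)
    where
    open ≡-Reasoning
    cross : Vertex → Vertex → ℤ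
    cross w v = + edges w v * g v * f w
    left : ∀ w → div g w * f w + sum (cross w) ≡ sum (λ v → + edges w v * g w * f w)
    left w = begin
      div g w * f w + sum (cross w)
        ≡⟨ cong (_+ sum (cross w)) (*-distribʳ-sum (f w) (λ v → + edges w v * (g w - g v))) ⟩
      sum (λ v → + edges w v * (g w - g v) * f w) + sum (cross w)
        ≡⟨ ∑-distrib-+ (λ v → + edges w v * (g w - g v) * f w) (cross w) ⟨
      sum (λ v → + edges w v * (g w - g v) * f w + cross w v)
        ≡⟨ sum-cong-≗ (λ v → lemma (+ edges w v) (g w) (g v) (f w)) ⟩
      sum (λ v → + edges w v * g w * f w) ∎
      where
      lemma : ∀ e a b c → e * (a - b) * c + e * b * c ≡ e * a * c
      lemma = solve-∀
    right : ∀ w → g w * div f w + sum (λ v → cross v w) ≡ sum (λ v → + edges w v * g w * f w)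
    right w = begin
      g w * div f w + sum (λ v → cross v w)
        ≡⟨ cong (_+ sum (λ v → cross v w)) (*-distribˡ-sum (g w) (λ v → + edges w v * (f w - f v))) ⟩
      sum (λ v → g w * (+ edges w v * (f w - f v))) + sum (λ v → cross v w)
        ≡⟨ ∑-distrib-+ (λ v → g w * (+ edges w v * (f w - f v))) (λ v → cross v w) ⟨
      sum (λ v → g w * (+ edges w v * (f w - f v)) + + edges v w * g w * f v)
        ≡⟨ sum-cong-≗ (λ v → cong (λ e → g w * (+ edges w v * (f w - f v)) + + e * g w * f v) (undirected v w)) ⟩
      sum (λ v → g w * (+ edges w v * (f w - f v)) + + edges w v * g w * f v)
        ≡⟨ sum-cong-≗ (λ v → lemma (+ edges w v) (g w) (f w) (f v)) ⟩
      sum (λ v → + edges w v * g w * f w) ∎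
      where
      lemma : ∀ e a b c → a * (e * (b - c)) + e * a * c ≡ e * a * b
      lemma = solve-∀

  sum-div : ∀ g → sum (div g) ≡ 0ℤ
  sum-div g = begin
    sum (div g)                        ≡⟨ sum-cong-≗ (λ w → ℤ.*-identityʳ (div g w)) ⟨
    sum (λ w → div g w * 1ℤ)           ≡⟨ div-self-adjoint g (λ _ → 1ℤ) ⟩
    sum (λ w → g w * div (λ _ → 1ℤ) w)
      ≡⟨ sum-0 (λ w → ≡.trans
           (cong (g w *_) (sum-0 (λ v → ℤ.*-zeroʳ (+ edges w v)))) (ℤ.*-zeroʳ (g w))) ⟩
    0ℤ                                 ∎
    where open ≡-Reasoning

module Isomorphism {c ℓ} (Γ : GroupWithPairing c ℓ)
                   (O : Diagonal.OrthogonalBasis Γ (λ _ → ⊤))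
                   (R : Realization (Diagonal.OrthogonalBasis.orders O)) where
  open GroupWithPairing Γ hiding (_-_) renaming (order to N)
  open Mult commutativeMonoid renaming (_×_ to _·_)
  open Sum commutativeMonoid using () renaming (sum to ∑)
  open GroupProperties group using (x∙y⁻¹≈ε⇒x≈y)
  open Diagonal Γ
  open OrthogonalBasis O
  open Realization R
  open Divisors graph

  n q : Fin rank → ℕ
  n = ord orders
  q = num orders

  -- B (basis i) (basis i) = weight i modulo N
  weight : Fin rank → ℤ
  weight i = + cofactor i * + q i

  E : Fin rank → Vertex → ℤ
  E i w = + δ (vertex i) w - + δ root w

  evaluate-E : ∀ i f → sum (λ w → E i w * f w) ≡ f (vertex i) - f root
  evaluate-E i f = begin
    sum (λ w → E i w * f w)
      ≡⟨ sum-cong-≗ (λ w → lemma (+ δ (vertex i) w) (+ δ root w) (f w)) ⟩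
    sum (λ w → + δ (vertex i) w * f w + - (+ δ root w * f w))
      ≡⟨ ∑-distrib-+ (λ w → + δ (vertex i) w * f w) (λ w → - (+ δ root w * f w)) ⟩
    sum (λ w → + δ (vertex i) w * f w) + sum (λ w → - (+ δ root w * f w))
      ≡⟨ cong₂ _+_ (sum-δ (vertex i) f) (≡.trans (sum-neg (λ w → + δ root w * f w)) (cong -_ (sum-δ root f))) ⟩
    f (vertex i) - f root ∎
    where
    open ≡-Reasoning
    lemma : ∀ a b x → (a - b) * x ≡ a * x + - (b * x)
    lemma = solve-∀

  combination : (Fin rank → ℤ) → Vertex → ℤ
  combination s w = sum (λ i → s i * E i w)

  evaluate : ∀ s f → sum (λ w → combination s w * f w) ≡ sum (λ i → s i * (f (vertex i) - f root))
  evaluate s f = begin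
    sum (λ w → combination s w * f w)
      ≡⟨ sum-cong-≗ (λ w → *-distribʳ-sum (f w) (λ i → s i * E i w)) ⟩
    sum (λ w → sum (λ i → s i * E i w * f w))
      ≡⟨ ∑-comm (λ w i → s i * E i w * f w) ⟩
    sum (λ i → sum (λ w → s i * E i w * f w))
      ≡⟨ sum-cong-≗ (λ i → sum-cong-≗ (λ w → ℤ.*-assoc (s i) (E i w) (f w))) ⟩
    sum (λ i → sum (λ w → s i * (E i w * f w)))
      ≡⟨ sum-cong-≗ (λ i → *-distribˡ-sum (s i) (λ w → E i w * f w)) ⟨
    sum (λ i → s i * sum (λ w → E i w * f w))
      ≡⟨ sum-cong-≗ (λ i → cong (s i *_) (evaluate-E i f)) ⟩
    sum (λ i → s i * (f (vertex i) - f root)) ∎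
    where open ≡-Reasoning

  deg-combination : ∀ s → deg (combination s) ≡ 0ℤ
  deg-combination s = begin
    sum (combination s)                    ≡⟨ sum-cong-≗ (λ w → ℤ.*-identityʳ (combination s w)) ⟨
    sum (λ w → combination s w * 1ℤ)       ≡⟨ evaluate s (λ _ → 1ℤ) ⟩
    sum (λ i → s i * 0ℤ)                   ≡⟨ sum-0 (λ i → ℤ.*-zeroʳ (s i)) ⟩
    0ℤ                                     ∎
    where open ≡-Reasoning

  β : (Fin rank → ℤ) → Div⁰
  β s = combination s , deg-combination s

  combination-+ : ∀ s t w → combination (λ i → s i + t i) w ≡ combination s w + combination t w
  combination-+ s t w = ≡.trans (sum-cong-≗ (λ i → ℤ.*-distribʳ-+ (E i w) (s i) (t i)))
    (∑-distrib-+ (λ i → s i * E i w) (λ i → t i * E i w))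

  combination-neg : ∀ s w → combination (λ i → - s i) w ≡ - combination s w
  combination-neg s w = ≡.trans (sum-cong-≗ (λ i → ≡.sym (ℤ.neg-distribˡ-* (s i) (E i w))))
    (sum-neg (λ i → s i * E i w))

  combination-- : ∀ s t w → combination s w - combination t w ≡ combination (λ i → s i - t i) w
  combination-- s t w = ≡.sym (≡.trans (combination-+ s (λ i → - t i) w)
    (cong (_+_ (combination s w)) (combination-neg t w)))

  potential-combination : (Fin rank → ℤ) → Vertex → ℤ
  potential-combination c w = sum (λ i → c i * potential i w)

  div-potential-combination : ∀ c v → div (potential-combination c) v ≡ combination (λ i → c i * + n i) v
  div-potential-combination c v = ≡.trans (div-combination c potential v)
    (sum-cong-≗ (λ i → ≡.trans (cong (c i *_) (div-potential i v))
      (≡.sym (ℤ.*-assoc (c i) (+ n i) (E i v)))))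

  -- The quotients of the congruences are the coefficients with which the voltage functions are
  -- combined.
  congruent⇒~ : ∀ {s t} → (∀ i → s i ≡ t i mod n i) → β s ~ β t
  congruent⇒~ {s} {t} s≡t = potential-combination k , λ v → begin
    combination s v - combination t v       ≡⟨ combination-- s t v ⟩
    combination (λ i → s i - t i) v         ≡⟨ sum-cong-≗ (λ i → cong (_* E i v) (difference i)) ⟩
    combination (λ i → k i * + n i) v       ≡⟨ div-potential-combination k v ⟨
    div (potential-combination k) v         ∎
    where
    open ≡-Reasoning
    k : Fin rank → ℤ
    k i = _≡_mod_.quotient (s≡t i)
    lemma : ∀ t x → t + x - t ≡ x
    lemma = solve-∀
    difference : ∀ i → s i - t i ≡ k i * + n i
    difference i = ≡.trans (cong (_- t i) (_≡_mod_.equality (s≡t i))) (lemma (t i) (k i * + n i))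

  -- Evaluate the divisor of `g` on the j-th voltage function. Directly, orthogonality leaves only
  -- (s j - t j) q j; by self-adjointness the result is a multiple of `n j`. Then the unit `q j`
  -- cancels.
  ~⇒congruent : ∀ {s t} → β s ~ β t → ∀ j → s j ≡ t j mod n j
  ~⇒congruent {s} {t} (g , eq) j = mod-cancel {q = q j} (ord⊥num j)
    (modulo (g (vertex j) - g root) (begin
      + q j * s j                               ≡⟨ lemma₁ (+ q j) (s j) (t j) ⟩
      + q j * t j + (s j - t j) * + q j         ≡⟨ cong (_+_ (+ q j * t j)) pairing ⟩
      + q j * t j + (g (vertex j) - g root) * + n j ∎))
    where
    open ≡-Reasoning
    lemma₁ : ∀ q s t → q * s ≡ q * t + (s - t) * q
    lemma₁ = solve-∀
    lemma₂ : ∀ x n e → x * (n * e) ≡ n * (e * x)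
    lemma₂ = solve-∀
    lemma₃ : ∀ x d q → x * (d * q - 0ℤ) ≡ x * q * d
    lemma₃ = solve-∀
    pairing : (s j - t j) * + q j ≡ (g (vertex j) - g root) * + n j
    pairing = begin
      (s j - t j) * + q j
        ≡⟨ sum-δʳ j (λ i → (s i - t i) * + q j) ⟨
      sum (λ i → (s i - t i) * + q j * + δ i j)
        ≡⟨ sum-cong-≗ (λ i → ≡.trans (cong (λ d → (s i - t i) * + q j * + d) (δ-sym i j))
             (≡.trans (≡.sym (lemma₃ (s i - t i) (+ δ j i) (+ q j)))
               (cong₂ (λ x y → (s i - t i) * (x - y)) (≡.sym (potential-vertex j i)) (≡.sym (potential-root j))))) ⟩
      sum (λ i → (s i - t i) * (potential j (vertex i) - potential j root))
        ≡⟨ evaluate (λ i → s i - t i) (potential j) ⟨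
      sum (λ w → combination (λ i → s i - t i) w * potential j w)
        ≡⟨ sum-cong-≗ (λ w → cong (_* potential j w) (≡.trans (≡.sym (combination-- s t w)) (eq w))) ⟩
      sum (λ w → div g w * potential j w)
        ≡⟨ div-self-adjoint g (potential j) ⟩
      sum (λ w → g w * div (potential j) w)
        ≡⟨ sum-cong-≗ (λ w → ≡.trans (cong (g w *_) (div-potential j w)) (lemma₂ (g w) (+ n j) (E j w))) ⟩
      sum (λ w → + n j * (E j w * g w))
        ≡⟨ *-distribˡ-sum (+ n j) (λ w → E j w * g w) ⟨
      + n j * sum (λ w → E j w * g w)
        ≡⟨ cong (+ n j *_) (evaluate-E j g) ⟩
      + n j * (g (vertex j) - g root)
        ≡⟨ ℤ.*-comm (+ n j) (g (vertex j) - g root) ⟩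
      (g (vertex j) - g root) * + n j ∎

  -- Coordinates are characterised through the pairing, since those chosen by `spans` need be
  -- neither additive nor compatible with `_≈_`. This relation is both, and it fixes each coordinate
  -- modulo its order, so `φ` is a homomorphism up to principal divisors.
  Represents : (Fin rank → ℤ) → Carrier → Set
  Represents s y = ∀ j → s j * weight j ≡ B y (basis j) mod N

  represents-∑ : ∀ (t : Fin rank → ℕ) → Represents (λ i → + t i) (∑ (λ i → t i · basis i))
  represents-∑ t j = begin
    + t j * weight j                                ≡⟨ sum-δʳ j (λ i → + t i * weight j) ⟨
    sum (λ i → + t i * weight j * + δ i j)
      ≡⟨ sum-cong-≗ (λ i → lemma (+ t i) (weight j) (+ δ i j)) ⟩
    sum (λ i → + t i * (+ δ i j * weight j))
      ≈⟨ mod-sum (λ i → mod-*ˡ (+ t i) (B-basis i j)) ⟨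
    sum (λ i → + t i * B (basis i) (basis j))       ≈⟨ B-∑ˡ t basis (basis j) ⟨
    B (∑ (λ i → t i · basis i)) (basis j)           ∎
    where
    open mod-Reasoning N
    lemma : ∀ t x d → t * x * d ≡ t * (d * x)
    lemma = solve-∀

  represents-≈ : ∀ {s y z} → y ≈ z → Represents s y → Represents s z
  represents-≈ y≈z rep j = mod-trans (rep j) (B-cong y≈z refl)

  represents-∙ : ∀ {s t y z} → Represents s y → Represents t z → Represents (λ i → s i + t i) (y ∙ z)
  represents-∙ {s} {t} {y} {z} rep-y rep-z j = mod-trans
    (mod-reflexive (ℤ.*-distribʳ-+ (weight j) (s j) (t j)))
    (mod-trans (mod-+ (rep-y j) (rep-z j)) (mod-sym (B-∙ˡ y z (basis j))))

  represents-⁻¹ : ∀ {s y} → Represents s y → Represents (λ i → - s i) (y ⁻¹)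
  represents-⁻¹ {s} {y} rep j = mod-trans (mod-reflexive (≡.sym (ℤ.neg-distribˡ-* (s j) (weight j))))
    (mod-trans (mod-neg (rep j)) (mod-sym (B-⁻¹ˡ y (basis j))))

  represents-ε : Represents (λ _ → 0ℤ) ε
  represents-ε j = mod-trans (mod-reflexive (ℤ.*-zeroˡ (weight j))) (mod-sym (B-εˡ (basis j)))

  -- With its converse `weight-cancel`: as `q j` is prime to `n j`, multiplication by the weight
  -- embeds ℤ/n j in ℤ/N.
  weight-scale : ∀ {s t} j → s ≡ t mod n j → s * weight j ≡ t * weight j mod N
  weight-scale {s} {t} j s≡t = mod-trans (mod-reflexive (lemma s (+ cofactor j) (+ q j)))
    (mod-trans (mod-scale (cofactor j) (ord*cofactor≡N j) (mod-*ˡ (+ q j) s≡t))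
      (mod-reflexive (≡.sym (lemma t (+ cofactor j) (+ q j)))))
    where
    lemma : ∀ s e q → s * (e * q) ≡ e * (q * s)
    lemma = solve-∀

  weight-cancel : ∀ {s t} j → s * weight j ≡ t * weight j mod N → s ≡ t mod n j
  weight-cancel {s} {t} j sw≡tw = mod-cancel {q = q j} (ord⊥num j)
    (mod-unscale (cofactor j) {{factorʳ {n j} (ord*cofactor≡N j)}} (ord*cofactor≡N j)
      (mod-trans (mod-reflexive (≡.sym (lemma s (+ cofactor j) (+ q j))))
        (mod-trans sw≡tw (mod-reflexive (lemma t (+ cofactor j) (+ q j))))))
    where
    lemma : ∀ s e q → s * (e * q) ≡ e * (q * s)
    lemma = solve-∀

  ≈⇒~ : ∀ {s t y z} → Represents s y → Represents t z → y ≈ z → β s ~ β t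
  ≈⇒~ {s} {t} rep-y rep-z y≈z = congruent⇒~ {s} {t} λ j →
    weight-cancel j (mod-trans (rep-y j) (mod-trans (B-cong y≈z refl) (mod-sym (rep-z j))))

  -- The quotient of `y` by `z` is orthogonal to the basis, hence to everything it spans.
  ~⇒≈ : ∀ {s t y z} → Represents s y → Represents t z → β s ~ β t → y ≈ z
  ~⇒≈ {s} {t} {y} {z} rep-y rep-z βs~βt = x∙y⁻¹≈ε⇒x≈y y z (B-nondegenerate (y ∙ z ⁻¹) λ w →
    vanishes w (spans {w} tt))
    where
    on-basis : ∀ j → B (basis j) (y ∙ z ⁻¹) ≡ 0ℤ mod N
    on-basis j = B-flip (begin
      B (y ∙ z ⁻¹) (basis j)                 ≈⟨ B-∙ˡ y (z ⁻¹) (basis j) ⟩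
      B y (basis j) + B (z ⁻¹) (basis j)
        ≈⟨ mod-+ {a = B y (basis j)} (mod-reflexive ≡.refl) (B-⁻¹ˡ z (basis j)) ⟩
      B y (basis j) - B z (basis j)          ≈⟨ mod-+ (mod-trans (mod-sym (rep-y j))
                                                  (mod-trans (weight-scale j (~⇒congruent {s} {t} βs~βt j)) (rep-z j)))
                                                  (mod-reflexive ≡.refl) ⟩
      B z (basis j) - B z (basis j)          ≡⟨ ℤ.+-inverseʳ (B z (basis j)) ⟩
      0ℤ                                     ∎)
      where open mod-Reasoning N
    vanishes : ∀ w → Σ[ t ∈ (Fin rank → ℕ) ] w ≈ ∑ (λ i → t i · basis i) → B (y ∙ z ⁻¹) w ≡ 0ℤ mod N
    vanishes w (t , w≈) = B-flip (begin
      B w (y ∙ z ⁻¹)                               ≈⟨ B-cong w≈ refl ⟩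
      B (∑ (λ i → t i · basis i)) (y ∙ z ⁻¹)       ≈⟨ B-∑ˡ t basis (y ∙ z ⁻¹) ⟩
      sum (λ i → + t i * B (basis i) (y ∙ z ⁻¹))   ≈⟨ mod-sum (λ i → mod-*ˡ (+ t i) (on-basis i)) ⟩
      sum (λ i → + t i * 0ℤ)                       ≡⟨ sum-0 (λ i → ℤ.*-zeroʳ (+ t i)) ⟩
      0ℤ                                           ∎)
      where open mod-Reasoning N

  coordinate : Carrier → Fin rank → ℕ
  coordinate y = proj₁ (spans {y} tt)

  coordinates : Carrier → Fin rank → ℤ
  coordinates y i = + coordinate y i

  represents-coordinates : ∀ y → Represents (coordinates y) y
  represents-coordinates y =
    represents-≈ {coordinates y} (sym (proj₂ (spans {y} tt))) (represents-∑ (coordinate y))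

  φ : Carrier → Div⁰
  φ y = β (coordinates y)

  φ-rep : ∀ {s y z} → Represents s z → y ≈ z → φ y ~ β s
  φ-rep {s} {y} rep-z = ≈⇒~ {coordinates y} {s} (represents-coordinates y) rep-z

  ~-≗ : ∀ {D E F} → D ~ E → (∀ v → proj₁ E v ≡ proj₁ F v) → D ~ F
  ~-≗ {D , _} (f , eq) E≗F = f , λ v → ≡.trans (cong (λ x → D v - x) (≡.sym (E≗F v))) (eq v)

  -- Trading each `vertex i` for `E i` moves all remaining coefficients to `root`, where their total
  -- s + sum t is 0 because `D` and principal divisors have degree 0.
  surjective : ∀ D → ∃[ y ] ∀ {z} → z ≈ y → φ z ~ D
  surjective (D , deg≡0) with generates D
  ... | s , t , g , eq = y , λ {z} z≈y →
    ~-trans {φ z} {β t} {D , deg≡0} (φ-rep {t} represents-y z≈y)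
      (~-sym {D , deg≡0} {β t} (g , λ v → begin
        D v - combination t v                           ≡⟨ residue v ⟩
        (s + sum t) * + δ root v + div g v
          ≡⟨ cong (λ x → x * + δ root v + div g v) u≡0 ⟩
        0ℤ * + δ root v + div g v
          ≡⟨ cong (_+ div g v) (ℤ.*-zeroˡ (+ δ root v)) ⟩
        0ℤ + div g v                                    ≡⟨ ℤ.+-identityˡ (div g v) ⟩
        div g v                                         ∎))
    where
    open ≡-Reasoning
    open AbelianGroup Jac using () renaming (trans to ~-trans; sym to ~-sym)
    instance
      n≢0 : ∀ {i} → NonZero (n i)
      n≢0 {i} = factorˡ {n i} (ord*cofactor≡N i)
    y : Carrier
    -- Multiples in Γ take natural coefficients, so each `t i` is replaced by its residue modulo the
    -- order.
    y = ∑ (λ i → (t i ℤ.%ℕ n i) · basis i)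
    represents-y : Represents t y
    represents-y j = mod-trans (weight-scale j (mod-sym (mod-% (t j))))
      (represents-∑ (λ i → t i ℤ.%ℕ n i) j)
    expand : ∀ v → combination t v ≡ sum (λ i → t i * + δ (vertex i) v) - sum t * + δ root v
    expand v = begin
      sum (λ i → t i * (+ δ (vertex i) v - + δ root v))
        ≡⟨ sum-cong-≗ (λ i → lemma (t i) (+ δ (vertex i) v) (+ δ root v)) ⟩
      sum (λ i → t i * + δ (vertex i) v + - (t i * + δ root v))
        ≡⟨ ∑-distrib-+ (λ i → t i * + δ (vertex i) v) (λ i → - (t i * + δ root v)) ⟩
      sum (λ i → t i * + δ (vertex i) v) + sum (λ i → - (t i * + δ root v))
        ≡⟨ cong (_+_ (sum (λ i → t i * + δ (vertex i) v)))
             (≡.trans (sum-neg (λ i → t i * + δ root v)) (cong -_ (≡.sym (*-distribʳ-sum (+ δ root v) t)))) ⟩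
      sum (λ i → t i * + δ (vertex i) v) - sum t * + δ root v ∎
      where
      lemma : ∀ t a b → t * (a - b) ≡ t * a + - (t * b)
      lemma = solve-∀
    residue : ∀ v → D v - combination t v ≡ (s + sum t) * + δ root v + div g v
    residue v = ≡.trans (cong₂ _-_ (eq v) (expand v))
      (lemma s (+ δ root v) (sum (λ i → t i * + δ (vertex i) v)) (div g v) (sum t))
      where
      lemma : ∀ s r x d y → s * r + x + d - (x - y * r) ≡ (s + y) * r + d
      lemma = solve-∀
    u≡0 : s + sum t ≡ 0ℤ
    u≡0 = begin
      s + sum t
        ≡⟨ sum-δ root (λ _ → s + sum t) ⟨
      sum (λ v → + δ root v * (s + sum t))
        ≡⟨ sum-cong-≗ (λ v → ℤ.*-comm (+ δ root v) (s + sum t)) ⟩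
      sum (λ v → (s + sum t) * + δ root v)
        ≡⟨ ℤ.+-identityʳ _ ⟨
      sum (λ v → (s + sum t) * + δ root v) + 0ℤ
        ≡⟨ cong (_+_ (sum (λ v → (s + sum t) * + δ root v))) (sum-div g) ⟨
      sum (λ v → (s + sum t) * + δ root v) + sum (div g)
        ≡⟨ ∑-distrib-+ (λ v → (s + sum t) * + δ root v) (div g) ⟨
      sum (λ v → (s + sum t) * + δ root v + div g v)
        ≡⟨ sum-cong-≗ residue ⟨
      sum (λ v → D v - combination t v)
        ≡⟨ ∑-distrib-+ D (λ v → - combination t v) ⟩
      sum D + sum (λ v → - combination t v)
        ≡⟨ cong₂ _+_ deg≡0 (≡.trans (sum-neg (combination t)) (cong -_ (deg-combination t))) ⟩
      0ℤ ∎

  preserves-pairing : ∀ x y → MonodromyPairing (φ x) (φ y) ⟨ x , y ⟩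
  preserves-pairing x y = record
    { m     = N
    ; f     = f
    ; div-f = λ v → begin
        div f v
          ≡⟨ div-potential-combination γ v ⟩
        sum (λ i → coordinates x i * + cofactor i * + n i * E i v)
          ≡⟨ sum-cong-≗ (λ i → ≡.trans (rearrange (coordinates x i) (+ cofactor i) (+ n i) (E i v))
               (cong (_* (coordinates x i * E i v)) (N≡ i))) ⟩
        sum (λ i → + N * (coordinates x i * E i v))
          ≡⟨ *-distribˡ-sum (+ N) (λ i → coordinates x i * E i v) ⟨
        + N * combination (coordinates x) v ∎
    ; value = mod⇒mod-ℤ {p = ⟨ x , y ⟩} {q = total ℚ./ N} (B-spec x y) (/-*-cancel total N) B≡total
    }
    where
    open ≡-Reasoning
    γ : Fin rank → ℤ
    -- The divisor of `potential i` is n i times `E i`; the factor N / n i brings every summand to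
    -- the common multiple N.
    γ i = coordinates x i * + cofactor i
    f : Vertex → ℤ
    f = potential-combination γ
    total : ℤ
    total = sum (λ v → combination (coordinates y) v * f v)
    rearrange : ∀ t e n d → t * e * n * d ≡ n * e * (t * d)
    rearrange = solve-∀
    N≡ : ∀ i → + n i * + cofactor i ≡ + N
    N≡ i = ≡.trans (≡.sym (ℤ.pos-* (n i) (cofactor i))) (cong +_ (ord*cofactor≡N i))
    f-root : f root ≡ 0ℤ
    f-root = sum-0 (λ i → ≡.trans (cong (γ i *_) (potential-root i)) (ℤ.*-zeroʳ (γ i)))
    f-vertex : ∀ j → f (vertex j) ≡ coordinates x j * weight j
    f-vertex j = begin
      sum (λ i → γ i * potential i (vertex j))
        ≡⟨ sum-cong-≗ (λ i → ≡.trans (cong (γ i *_) (potential-vertex i j))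
             (lemma (coordinates x i) (+ cofactor i) (+ δ i j) (+ q i))) ⟩
      sum (λ i → coordinates x i * weight i * + δ i j)
        ≡⟨ sum-δʳ j (λ i → coordinates x i * weight i) ⟩
      coordinates x j * weight j ∎
      where
      lemma : ∀ t e d q → t * e * (d * q) ≡ t * (e * q) * d
      lemma = solve-∀
    total≡ : total ≡ sum (λ j → coordinates y j * (coordinates x j * weight j))
    total≡ = ≡.trans (evaluate (coordinates y) f) (sum-cong-≗ (λ j → cong (coordinates y j *_)
      (≡.trans (cong₂ _-_ (f-vertex j) f-root) (ℤ.+-identityʳ _))))
    B≡total : B x y ≡ total mod N
    B≡total = B-flip (mod-trans (B-cong (proj₂ (spans {y} tt)) refl)
      (mod-trans (B-∑ˡ (coordinate y) basis x)
        (mod-trans (mod-sum (λ j → mod-*ˡ (coordinates y j)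
            (B-flip (mod-sym (represents-coordinates x j)))))
          (mod-reflexive (≡.sym total≡)))))

  isomorphism : Γ ≅Jac graph
  isomorphism = record
    { φ = φ
    ; isIsomorphism = record
      { isGroupMonomorphism = record
        { isGroupHomomorphism = record
          { isMonoidHomomorphism = record
            { isMagmaHomomorphism = record
              { isRelHomomorphism = record
                { cong = λ {y} {z} → φ-rep {coordinates z} {y} (represents-coordinates z) }
              ; homo = λ y z → ~-≗
                  {φ (y ∙ z)} {β (λ i → coordinates y i + coordinates z i)} {φ y +⁰ φ z}
                  (φ-rep {λ i → coordinates y i + coordinates z i}
                    (represents-∙ {coordinates y} {coordinates z}
                      (represents-coordinates y) (represents-coordinates z)) refl)
                  (combination-+ (coordinates y) (coordinates z))
              }
            ; ε-homo = ~-≗ {φ ε} {β (λ _ → 0ℤ)} {0⁰} (φ-rep {λ _ → 0ℤ} represents-ε refl)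
                (λ v → sum-0 (λ i → ℤ.*-zeroˡ (E i v)))
            }
          ; ⁻¹-homo = λ y → ~-≗ {φ (y ⁻¹)} {β (λ i → - coordinates y i)} { -⁰ φ y }
              (φ-rep {λ i → - coordinates y i}
                (represents-⁻¹ {coordinates y} (represents-coordinates y)) refl)
              (combination-neg (coordinates y))
          }
        ; injective = λ {y} {z} → ~⇒≈ {coordinates y} {coordinates z}
            (represents-coordinates y) (represents-coordinates z)
        }
      ; surjective = surjective
      }
    ; preservesPairing = preserves-pairing
    }

theorem2 : GRH → ∀ {c ℓ} (Γ : GroupWithPairing c ℓ) → OddOrder Γ → Σ[ G ∈ Graph ] (Γ ≅Jac G)
theorem2 _ Γ odd = Realization.graph network , Isomorphism.isomorphism Γ O network
  where
  open Diagonal Γ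
  O : OrthogonalBasis (λ _ → ⊤)
  O = whole-basis odd
  open OrthogonalBasis O
  network : Realization orders
  network = realize orders (λ i → factorˡ {ord orders i} (ord*cofactor≡N i)) ord⊥num
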